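{- Let $(G_n)_{n\ge 0}$ be the sequence of graphs with special vertices $X_n,Y_n$ defined in the context, let $T_n(x,y)=T(G_n;x,y)$ be the Tutte polynomial of $G_n$, and let $T_{1,n}(x,y)$ and $N_n(x,y)$ be the polynomials in $\mathbb{Z}[x,y]$ defined in the context. Then for every $n\ge 0$ the Tutte polynomial of $G_{n+1}$ is given by $$T_{n+1}(x,y)=T_{1,n+1}(x,y)+(x-1)N_{n+1}(x,y),$$ where the polynomials $T_{1,n+1}$ and $N_{n+1}$ satisfy the following recursive relations (with $T_{1,n}=T_{1,n}(x,y)$, $N_n=N_n(x,y)$): $$T_{1,n+1}(x,y)=y(y-1)\,T_{1,n}^{4}+4y\,T_{1,n}^{3}N_{n}+(2x+2)\,T_{1,n}^{2}N_{n}^{2},$$ $$N_{n+1}(x,y)=(2y+2)\,T_{1,n}^{2}N_{n}^{2}+4x\,T_{1,n}N_{n}^{3}+x(x-1)\,N_{n}^{4},$$ with initial conditions $T_{1,0}(x,y)=1$ and $N_{0}(x,y)=1$.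
   Context: Tutte polynomial: for a graph $G$ with vertex set $V(G)$, edge set $E(G)$ and $k(G)$ connected components, put $r(G)=|V(G)|-k(G)$ and $n(G)=|E(G)|-|V(G)|+k(G)$. Then $T(G;x,y)=\sum_{H\subseteq G}(x-1)^{r(G)-r(H)}(y-1)^{n(H)}$, where the sum runs over all spanning subgraphs $H$ of $G$ (subgraphs with $V(H)=V(G)$ and arbitrary $E(H)\subseteq E(G)$). The graphs $G_n$: $G_0$ is the complete graph $K_2$ with its two vertices denoted $X_0,Y_0$. For $n\ge 0$, given $G_n$ with two special vertices $X_n,Y_n$, take four disjoint copies $G_n^1,G_n^2,G_n^3,G_n^4$ of $G_n$, with special vertices $X_n^i,Y_n^i$. Identify $X_n^1$ with $X_n^2$ to form the special vertex $X_{n+1}$ of $G_{n+1}$; identify $Y_n^3$ with $Y_n^4$ to form the special vertex $Y_{n+1}$ of $G_{n+1}$; identify $Y_n^1$ with $X_n^3$ to form a vertex $a$, and $Y_n^2$ with $X_n^4$ to form a vertex $b$; finally add a new edge $e_n$ joining $a$ and $b$. The result is $G_{n+1}$. Partial sums: let $\mathcal{G}_{1,n}$ be the set of spanning subgraphs $H$ of $G_n$ in which $X_n$ and $Y_n$ belong to the same connected component of $H$, and $\mathcal{G}_{2,n}$ the set of spanning subgraphs in which $X_n$ and $Y_n$ do not belong to the same component. For $i=1,2$, $T_{i,n}(x,y)=\sum_{H\in\mathcal{G}_{i,n}}(x-1)^{r(G_n)-r(H)}(y-1)^{n(H)}$. The polynomial $x-1$ divides $T_{2,n}(x,y)$ in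 $\mathbb{Z}[x,y]$, and $N_n(x,y)\in\mathbb{Z}[x,y]$ denotes the quotient, i.e. $T_{2,n}(x,y)=(x-1)N_n(x,y)$. -}

module Defs where

open import Algebra.Bundles using (CommutativeRing; Semiring)
import Algebra.Definitions.RawSemiring as RawSemiring
import Algebra.Properties.Ring as RingProperties
open import Data.Fin.Base using (Fin; zero; suc; _↑ʳ_; combine)
open import Data.Fin.Patterns using (0F; 1F; 2F; 3F)
import Data.Fin.Properties as Fin
import Data.Integer.Properties as ℤ
open import Data.List.Base as List
  using (List; []; _∷_; _++_; map; length; filter; foldr; deduplicate; allFin; concatMap)
open import Data.List.Membership.Propositional using (_∈_)
open import Data.List.Relation.Unary.Any using (here; there)
import Data.Nat.Base as ℕ
open ℕ using (ℕ; zero; suc)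
open import Data.Product.Base as Product using (_×_; _,_)
open import Data.Sum.Base using (_⊎_; inj₁; inj₂)
open import Relation.Binary.Construct.Closure.Equivalence as EqC using (EqClosure)
open import Relation.Binary.Construct.Closure.ReflexiveTransitive using (ε; _◅_; _◅◅_)
open import Relation.Binary.Construct.Closure.Symmetric using (fwd; bwd)
open import Relation.Binary.Definitions using (Decidable)
open import Relation.Binary.PropositionalEquality.Core using (_≡_; refl)
open import Relation.Nullary.Decidable using (map′; ¬?; _×-dec_; _⊎-dec_)

-- R[t] for a commutative ring R: the coefficient list a₀ ∷ a₁ ∷ … stands for
-- a₀ + a₁ t + …, and trailing zeros are not normalised away, so equality is
-- coefficientwise.
module Polynomial {c ℓ} (R : CommutativeRing c ℓ) where

  private
    module R = CommutativeRing R
    open R using (Carrier; 0#; 1#)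

  Poly : Set c
  Poly = List Carrier

  coeff : Poly → ℕ → Carrier
  coeff []      _       = 0#
  coeff (a ∷ p) zero    = a
  coeff (a ∷ p) (suc i) = coeff p i

  infix 4 _≈_
  record _≈_ (p q : Poly) : Set ℓ where
    constructor coeffwise
    field coeff-≈ : ∀ i → coeff p i R.≈ coeff q i
  open _≈_ public

  infixl 6 _+_
  _+_ : Poly → Poly → Poly
  []      + q       = q
  (a ∷ p) + []      = a ∷ p
  (a ∷ p) + (b ∷ q) = (a R.+ b) ∷ (p + q)

  infix 8 -_
  -_ : Poly → Poly
  -_ = map (λ a → R.- a)

  scale : Carrier → Poly → Poly
  scale a = map (a R.*_)

  infixl 7 _*_
  _*_ : Poly → Poly → Poly
  []      * q = []
  (a ∷ p) * q = scale a q + (0# ∷ p * q)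

  constant : Carrier → Poly
  constant a = a ∷ []

  indeterminate : Poly
  indeterminate = 0# ∷ 1# ∷ []

  private
    ≈-refl : ∀ {p} → p ≈ p
    ≈-refl .coeff-≈ _ = R.refl

    ≈-sym : ∀ {p q} → p ≈ q → q ≈ p
    ≈-sym e .coeff-≈ i = R.sym (coeff-≈ e i)

    ≈-trans : ∀ {p q r} → p ≈ q → q ≈ r → p ≈ r
    ≈-trans e f .coeff-≈ i = R.trans (coeff-≈ e i) (coeff-≈ f i)

  coeff-+ : ∀ p q i → coeff (p + q) i R.≈ coeff p i R.+ coeff q i
  coeff-+ []      q       i       = R.sym (R.+-identityˡ _)
  coeff-+ (a ∷ p) []      i       = R.sym (R.+-identityʳ _)
  coeff-+ (a ∷ p) (b ∷ q) zero    = R.refl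
  coeff-+ (a ∷ p) (b ∷ q) (suc i) = coeff-+ p q i

  coeff-neg : ∀ p i → coeff (- p) i R.≈ R.- coeff p i
  coeff-neg []      i       = R.sym (RingProperties.-0#≈0# R.ring)
  coeff-neg (a ∷ p) zero    = R.refl
  coeff-neg (a ∷ p) (suc i) = coeff-neg p i

  coeff-scale : ∀ a p i → coeff (scale a p) i R.≈ a R.* coeff p i
  coeff-scale a []      i       = R.sym (R.zeroʳ a)
  coeff-scale a (b ∷ p) zero    = R.refl
  coeff-scale a (b ∷ p) (suc i) = coeff-scale a p i

  ∷-cong : ∀ {a b p q} → a R.≈ b → p ≈ q → (a ∷ p) ≈ (b ∷ q)
  ∷-cong e f .coeff-≈ zero    = e
  ∷-cong e f .coeff-≈ (suc i) = coeff-≈ f i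

  private
    0∷[] : ∀ {p} → p ≈ [] → (0# ∷ p) ≈ []
    0∷[] e .coeff-≈ zero    = R.refl
    0∷[] e .coeff-≈ (suc i) = coeff-≈ e i

    +-cong : ∀ {p p′ q q′} → p ≈ p′ → q ≈ q′ → p + q ≈ p′ + q′
    +-cong {p} {p′} {q} {q′} e f .coeff-≈ i =
      R.trans (coeff-+ p q i)
        (R.trans (R.+-cong (coeff-≈ e i) (coeff-≈ f i)) (R.sym (coeff-+ p′ q′ i)))

    +-assoc : ∀ p q r → (p + q) + r ≈ p + (q + r)
    +-assoc p q r .coeff-≈ i =
      R.trans (coeff-+ (p + q) r i)
        (R.trans (R.+-congʳ (coeff-+ p q i))
          (R.trans (R.+-assoc _ _ _)
            (R.sym (R.trans (coeff-+ p (q + r) i) (R.+-congˡ (coeff-+ q r i))))))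

    +-comm : ∀ p q → p + q ≈ q + p
    +-comm p q .coeff-≈ i =
      R.trans (coeff-+ p q i) (R.trans (R.+-comm _ _) (R.sym (coeff-+ q p i)))

    +-identityʳ : ∀ p → p + [] ≈ p
    +-identityʳ []      = ≈-refl
    +-identityʳ (a ∷ p) = ≈-refl

    neg-cong : ∀ {p q} → p ≈ q → - p ≈ - q
    neg-cong {p} {q} e .coeff-≈ i =
      R.trans (coeff-neg p i) (R.trans (R.-‿cong (coeff-≈ e i)) (R.sym (coeff-neg q i)))

    neg-inverseˡ : ∀ p → - p + p ≈ []
    neg-inverseˡ p .coeff-≈ i =
      R.trans (coeff-+ (- p) p i)
        (R.trans (R.+-congʳ (coeff-neg p i)) (R.-‿inverseˡ _))

    scale-cong : ∀ {a b p q} → a R.≈ b → p ≈ q → scale a p ≈ scale b q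
    scale-cong {a} {b} {p} {q} e f .coeff-≈ i =
      R.trans (coeff-scale a p i)
        (R.trans (R.*-cong e (coeff-≈ f i)) (R.sym (coeff-scale b q i)))

    scale-+ : ∀ a p q → scale a (p + q) ≈ scale a p + scale a q
    scale-+ a p q .coeff-≈ i =
      R.trans (coeff-scale a (p + q) i)
        (R.trans (R.*-congˡ (coeff-+ p q i))
          (R.trans (R.distribˡ _ _ _)
            (R.sym (R.trans (coeff-+ (scale a p) (scale a q) i)
              (R.+-cong (coeff-scale a p i) (coeff-scale a q i))))))

    scale-scale : ∀ a b p → scale a (scale b p) ≈ scale (a R.* b) p
    scale-scale a b p .coeff-≈ i =
      R.trans (coeff-scale a (scale b p) i)
        (R.trans (R.*-congˡ (coeff-scale b p i))
          (R.trans (R.sym (R.*-assoc _ _ _)) (R.sym (coeff-scale (a R.* b) p i))))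

    scale-0 : ∀ p → scale 0# p ≈ []
    scale-0 p .coeff-≈ i = R.trans (coeff-scale 0# p i) (R.zeroˡ _)

    scale-1 : ∀ p → scale 1# p ≈ p
    scale-1 p .coeff-≈ i = R.trans (coeff-scale 1# p i) (R.*-identityˡ _)

    +-interchange : ∀ p q r s → (p + q) + (r + s) ≈ (p + r) + (q + s)
    +-interchange p q r s =
      ≈-trans (+-assoc p q (r + s))
        (≈-trans (+-cong (≈-refl {p}) swap) (≈-sym (+-assoc p r (q + s))))
      where
      swap : q + (r + s) ≈ r + (q + s)
      swap = ≈-trans (≈-sym (+-assoc q r s))
               (≈-trans (+-cong (+-comm q r) (≈-refl {s})) (+-assoc r q s))

    +-swap : ∀ p q r → p + (q + r) ≈ q + (p + r)
    +-swap p q r =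
      ≈-trans (≈-sym (+-assoc p q r))
        (≈-trans (+-cong (+-comm p q) (≈-refl {r})) (+-assoc q p r))

    *-congˡ : ∀ p {q r} → q ≈ r → p * q ≈ p * r
    *-congˡ []      e = ≈-refl
    *-congˡ (a ∷ p) e = +-cong (scale-cong R.refl e) (∷-cong R.refl (*-congˡ p e))

    *-zeroʳ : ∀ p → p * [] ≈ []
    *-zeroʳ []      = ≈-refl
    *-zeroʳ (a ∷ p) = 0∷[] (*-zeroʳ p)

    *-∷ʳ : ∀ q a p → q * (a ∷ p) ≈ scale a q + (0# ∷ q * p)
    *-∷ʳ []      a p = ≈-sym (0∷[] ≈-refl)
    *-∷ʳ (b ∷ q) a p = ∷-cong (R.+-congʳ (R.*-comm b a))
      (≈-trans (+-cong (≈-refl {scale b p}) (*-∷ʳ q a p))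
        (+-swap (scale b p) (scale a q) (0# ∷ q * p)))

    *-comm : ∀ p q → p * q ≈ q * p
    *-comm []      q = ≈-sym (*-zeroʳ q)
    *-comm (a ∷ p) q =
      ≈-trans (+-cong (≈-refl {scale a q}) (∷-cong R.refl (*-comm p q)))
        (≈-sym (*-∷ʳ q a p))

    *-cong : ∀ {p p′ q q′} → p ≈ p′ → q ≈ q′ → p * q ≈ p′ * q′
    *-cong {p} {p′} {q} {q′} e f =
      ≈-trans (*-congˡ p f)
        (≈-trans (*-comm p q′) (≈-trans (*-congˡ q′ e) (*-comm q′ p′)))

    *-distribˡ : ∀ p q r → p * (q + r) ≈ p * q + p * r
    *-distribˡ []      q r = ≈-refl
    *-distribˡ (a ∷ p) q r =
      ≈-trans
        (+-cong (scale-+ a q r) (∷-cong (R.sym (R.+-identityʳ 0#)) (*-distribˡ p q r)))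
        (+-interchange (scale a q) (scale a r) (0# ∷ p * q) (0# ∷ p * r))

    *-distribʳ : ∀ p q r → (q + r) * p ≈ q * p + r * p
    *-distribʳ p q r =
      ≈-trans (*-comm (q + r) p)
        (≈-trans (*-distribˡ p q r) (+-cong (*-comm p q) (*-comm p r)))

    scale-* : ∀ a p q → scale a p * q ≈ scale a (p * q)
    scale-* a []      q = ≈-refl
    scale-* a (b ∷ p) q =
      ≈-trans
        (+-cong (≈-sym (scale-scale a b q)) (∷-cong (R.sym (R.zeroʳ a)) (scale-* a p q)))
        (≈-sym (scale-+ a (scale b q) (0# ∷ p * q)))

    *-assoc : ∀ p q r → (p * q) * r ≈ p * (q * r)
    *-assoc []      q r = ≈-refl
    *-assoc (a ∷ p) q r =
      ≈-trans (*-distribʳ r (scale a q) (0# ∷ p * q))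
        (+-cong (scale-* a q r)
          (+-cong (scale-0 r) (∷-cong R.refl (*-assoc p q r))))

    *-identityˡ : ∀ p → constant 1# * p ≈ p
    *-identityˡ p =
      ≈-trans (+-cong (scale-1 p) (0∷[] ≈-refl)) (+-identityʳ p)

  commutativeRing : CommutativeRing c ℓ
  commutativeRing = record
    { Carrier = Poly ; _≈_ = _≈_ ; _+_ = _+_ ; _*_ = _*_ ; -_ = -_
    ; 0# = [] ; 1# = constant 1#
    ; isCommutativeRing = record
      { isRing = record
        { +-isAbelianGroup = record
          { isGroup = record
            { isMonoid = record
              { isSemigroup = record
                { isMagma = record
                  { isEquivalence = record { refl = ≈-refl ; sym = ≈-sym ; trans = ≈-trans }
                  ; ∙-cong = +-cong }
                ; assoc = +-assoc }
              ; identity = (λ _ → ≈-refl) , +-identityʳ }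
            ; inverse = neg-inverseˡ
                      , λ p → ≈-trans (+-comm p (- p)) (neg-inverseˡ p)
            ; ⁻¹-cong = neg-cong }
          ; comm = +-comm }
        ; *-cong = *-cong
        ; *-assoc = *-assoc
        ; *-identity = *-identityˡ
                     , λ p → ≈-trans (*-comm p (constant 1#)) (*-identityˡ p)
        ; distrib = *-distribˡ , *-distribʳ }
      ; *-comm = *-comm } }

-- ℤ[x,y] is constructed as ℤ[y][x].
private
  module Y = Polynomial ℤ.+-*-commutativeRing
  module X = Polynomial Y.commutativeRing

ℤ[x,y] : CommutativeRing _ _
ℤ[x,y] = X.commutativeRing

open CommutativeRing ℤ[x,y] public
  using (0#; 1#; _≈_; _+_; _*_; _-_) renaming (Carrier to ℤ[x,y]ᶜ)

-- n · p is the n-fold sum p + … + p.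
open RawSemiring (Semiring.rawSemiring (CommutativeRing.semiring ℤ[x,y])) public
  using (_^_) renaming (_×_ to infixr 8 _·_)

x y : ℤ[x,y]ᶜ
x = X.indeterminate
y = X.constant Y.indeterminate

∑ : ∀ {a} {A : Set a} → List A → (A → ℤ[x,y]ᶜ) → ℤ[x,y]ᶜ
∑ as f = foldr (λ a s → f a + s) 0# as

-- A finite multigraph with vertex set Fin v, given by its list of edges.  The
-- order of the two ends of an edge carries no meaning.
Graph : ℕ → Set
Graph v = List (Fin v × Fin v)

-- One entry for each subset of the positions of the list.
sublists : ∀ {a} {A : Set a} → List A → List (List A)
sublists []       = [] ∷ []
sublists (a ∷ as) = sublists as ++ map (a ∷_) (sublists as)

spanningSubgraphs : ∀ {v} → Graph v → List (Graph v)
spanningSubgraphs = sublists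

Connected : ∀ {v} → Graph v → Fin v → Fin v → Set
Connected H = EqClosure (λ u w → (u , w) ∈ H)

private
  weaken : ∀ {v} {H : Graph v} {e u w} → Connected H u w → Connected (e ∷ H) u w
  weaken = EqC.map there

  flip-path : ∀ {v} {H : Graph v} {u w} → Connected H u w → Connected H w u
  flip-path {H = H} = EqC.symmetric (λ u w → (u , w) ∈ H)

  Via : ∀ {v} → Graph v → Fin v → Fin v → Fin v → Fin v → Set
  Via H s t u w = Connected H u w
                ⊎ (Connected H u s × Connected H t w)
                ⊎ (Connected H u t × Connected H s w)

  via⇒connected : ∀ {v} {H : Graph v} {s t u w} →
                  Via H s t u w → Connected ((s , t) ∷ H) u w
  via⇒connected (inj₁ p) = weaken p
  via⇒connected (inj₂ (inj₁ (p , q))) = weaken p ◅◅ (fwd (here refl) ◅ weaken q)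
  via⇒connected (inj₂ (inj₂ (p , q))) = weaken p ◅◅ (bwd (here refl) ◅ weaken q)

  connected⇒via : ∀ {v} {H : Graph v} {s t u w} →
                  Connected ((s , t) ∷ H) u w → Via H s t u w
  connected⇒via ε = inj₁ ε
  connected⇒via (fwd (here refl) ◅ p) with connected⇒via p
  ... | inj₁ q              = inj₂ (inj₁ (ε , q))
  ... | inj₂ (inj₁ (_ , q)) = inj₂ (inj₁ (ε , q))
  ... | inj₂ (inj₂ (_ , q)) = inj₁ q
  connected⇒via (bwd (here refl) ◅ p) with connected⇒via p
  ... | inj₁ q              = inj₂ (inj₂ (ε , q))
  ... | inj₂ (inj₁ (_ , q)) = inj₁ q
  ... | inj₂ (inj₂ (_ , q)) = inj₂ (inj₂ (ε , q))
  connected⇒via (fwd (there i) ◅ p) with connected⇒via p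
  ... | inj₁ q              = inj₁ (fwd i ◅ q)
  ... | inj₂ (inj₁ (q , r)) = inj₂ (inj₁ (fwd i ◅ q , r))
  ... | inj₂ (inj₂ (q , r)) = inj₂ (inj₂ (fwd i ◅ q , r))
  connected⇒via (bwd (there i) ◅ p) with connected⇒via p
  ... | inj₁ q              = inj₁ (bwd i ◅ q)
  ... | inj₂ (inj₁ (q , r)) = inj₂ (inj₁ (bwd i ◅ q , r))
  ... | inj₂ (inj₂ (q , r)) = inj₂ (inj₂ (bwd i ◅ q , r))

connected? : ∀ {v} (H : Graph v) → Decidable (Connected H)
connected? []            u w = map′ (λ { refl → ε }) no-edge (u Fin.≟ w)
  where
  no-edge : Connected [] u w → u ≡ w
  no-edge ε            = refl
  no-edge (fwd () ◅ _)
  no-edge (bwd () ◅ _)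
connected? ((s , t) ∷ H) u w = map′ via⇒connected connected⇒via
  (connected? H u w
    ⊎-dec ((connected? H u s ×-dec connected? H t w)
    ⊎-dec (connected? H u t ×-dec connected? H s w)))

-- `deduplicate` keeps exactly one vertex of each connected component.
k : ∀ {v} → Graph v → ℕ
k {v} H = length (deduplicate (connected? H) (allFin v))

-- The truncated subtractions here and in `weight` are never actually truncated:
-- k H ≤ v ≤ length H + k H, and r H ≤ r G for a spanning subgraph H of G.
r : ∀ {v} → Graph v → ℕ
r {v} H = v ℕ.∸ k H

nullity : ∀ {v} → Graph v → ℕ
nullity {v} H = (length H ℕ.+ k H) ℕ.∸ v

weight : ∀ {v} → Graph v → Graph v → ℤ[x,y]ᶜ
weight G H = (x - 1#) ^ (r G ℕ.∸ r H) * (y - 1#) ^ nullity H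

tutte : ∀ {v} → Graph v → ℤ[x,y]ᶜ
tutte G = ∑ (spanningSubgraphs G) (weight G)

-- A graph with two distinct special vertices X, Y and m further vertices has
-- vertex set Fin (2 + m), with X and Y numbered first.
X Y : ∀ {m} → Fin (2 ℕ.+ m)
X = 0F
Y = 1F

a b : ∀ {m} → Fin (4 ℕ.+ m)
a = 2F
b = 3F

-- The quotient map from four disjoint copies of the vertex set onto the vertices
-- X, Y, a, b of the glued graph followed by the 4 * m non-special ones.
glue : ∀ {m} → Fin 4 → Fin (2 ℕ.+ m) → Fin (4 ℕ.+ 4 ℕ.* m)
glue 0F 0F          = X
glue 0F 1F          = a
glue 1F 0F          = X
glue 1F 1F          = b
glue 2F 0F          = a
glue 2F 1F          = Y
glue 3F 0F          = b
glue 3F 1F          = Y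
glue i  (suc (suc u)) = 4 ↑ʳ combine i u

next : ∀ {m} → Graph (2 ℕ.+ m) → Graph (4 ℕ.+ 4 ℕ.* m)
next G = (a , b) ∷ concatMap (λ i → map (Product.map (glue i) (glue i)) G) (allFin 4)

others : ℕ → ℕ
others zero    = 0
others (suc n) = 2 ℕ.+ 4 ℕ.* others n

G : ∀ n → Graph (2 ℕ.+ others n)
G zero    = (X , Y) ∷ []
G (suc n) = next (G n)

𝒢₁ 𝒢₂ : ∀ n → List (Graph (2 ℕ.+ others n))
𝒢₁ n = filter (λ H → connected? H X Y) (spanningSubgraphs (G n))
𝒢₂ n = filter (λ H → ¬? (connected? H X Y)) (spanningSubgraphs (G n))

T T₁ T₂ : ℕ → ℤ[x,y]ᶜ
T n  = tutte (G n)
T₁ n = ∑ (𝒢₁ n) (weight (G n))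
T₂ n = ∑ (𝒢₂ n) (weight (G n))

-- N n is the quotient of T₂ n by x - 1, unique since x - 1 is not a zero divisor.
IsQuotient : (ℕ → ℤ[x,y]ᶜ) → Set
IsQuotient N = ∀ n → T₂ n ≈ (x - 1#) * N n

{-# OPTIONS --safe #-}
module Submission where

-- The weight of a spanning subgraph depends only on its rank (v minus the number of
-- components), its number of edges and whether it joins X and Y.  Ranks are computed one
-- edge at a time, an edge raising the rank iff its ends were not connected before.  Hence, in
-- a graph glued from four subgraphs H₀, …, H₃ at their special vertices, each Hᵢ may be
-- replaced by a single edge if it joins its special vertices and by nothing otherwise, at the
-- cost of a constant depending only on Hᵢ.  The weight is thereby the product of the weights
-- of the Hᵢ and a factor read off from one of the 2⁵ subgraphs of the diamond K₄ − XY; summing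
-- over all of them expands T₁ and N of the next graph as quartic forms in T₁ and N.

open import Defs hiding (_+_; _*_; _≈_; 0#; 1#; _^_; _·_; ∑)
open import Algebra.Bundles using (CommutativeRing; CommutativeSemiring)
import Algebra.Definitions.RawSemiring as RawSemiring
import Algebra.Properties.Monoid.Mult as Mult
import Algebra.Properties.Ring as RingProperties
import Algebra.Properties.Semiring.Exp as Exp
import Algebra.Solver.Ring.NaturalCoefficients.Default as NaturalCoefficients
open import Data.Bool.Base as Bool using (Bool; true; false; not; if_then_else_; _∧_)
open import Data.Bool.Properties using (T-∧)
open import Data.Fin.Base using (Fin; zero; suc; _↑ʳ_; combine)
open import Data.Fin.Patterns using (0F; 1F; 2F; 3F)
import Data.Fin.Properties as Fin
import Data.Integer.Properties as ℤ
open import Data.List.Base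
  using (List; []; _∷_; _++_; map; foldr; length; filter; deduplicate; allFin; concatMap)
open import Data.List.Membership.Propositional using (_∈_)
open import Data.List.Membership.Propositional.Properties
  using (∈-map⁺; ∈-map⁻; ∈-++⁺ˡ; ∈-++⁺ʳ; ∈-++⁻)
import Data.List.Properties as List
open import Data.List.Relation.Unary.All as All using (All; []; _∷_)
import Data.List.Relation.Unary.All.Properties as All
open import Data.List.Relation.Unary.AllPairs using (AllPairs; []; _∷_)
import Data.List.Relation.Unary.AllPairs.Properties as AllPairs
open import Data.List.Relation.Unary.Any as Any using (Any; any?; here; there)
import Data.List.Relation.Unary.Any.Properties as Any
import Data.List.Relation.Unary.Unique.Propositional.Properties as Unique
open import Data.Nat.Base as ℕ using (ℕ; zero; suc; _∸_; _≤_; _≤ᵇ_; z≤n; s≤s)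
open import Data.Nat.ListAction using (sum)
import Data.Nat.Properties as ℕ
open import Data.Nat.Solver using (module +-*-Solver)
open import Data.Product.Base as Product using (_×_; _,_; ∃; proj₁; proj₂)
open import Data.Sum.Base as Sum using (_⊎_; inj₁; inj₂; [_,_]′)
open import Data.Unit.Base using (tt)
open import Data.Vec.Base using (Vec; []; _∷_)
open import Function.Base using (_∘_; id)
open import Function.Bundles using (_⇔_; mk⇔; Equivalence)
import Level
import Relation.Binary.Construct.Closure.Equivalence as EqC
open import Relation.Binary.Construct.Closure.ReflexiveTransitive using (ε; _◅_; _◅◅_)
open import Relation.Binary.Construct.Closure.Symmetric using (fwd; bwd)
open import Relation.Binary.Core using (Rel)
open import Relation.Binary.Definitions using (Decidable)
open import Relation.Binary.PropositionalEquality
  using (_≡_; _≢_; refl; sym; trans; cong; cong₂; subst; module ≡-Reasoning)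
import Relation.Binary.Reasoning.Setoid as SetoidReasoning
open import Relation.Binary.Structures using (IsEquivalence)
open import Relation.Nullary using (¬_; Dec; yes; no; does; contradiction)
open import Relation.Nullary.Decidable
  using (dec-true; does-⇔; ¬?; _×-dec_; _⊎-dec_)

private variable
  A B : Set

open Equivalence using (to; from)

dec-true⁻ : (A? : Dec A) → does A? ≡ true → A
dec-true⁻ (yes p) _ = p

𝟙 : Bool → ℕ
𝟙 true  = 1
𝟙 false = 0

-- Counting equivalence classes

module _ {R : Rel A Level.zero} (R? : Decidable R) (isEq : IsEquivalence R) where

  private module R = IsEquivalence isEq

  -- Pairwise inequivalent elements lie in different classes, so at most one of them is removed.
  length-filter-≁ : ∀ x {ds} → AllPairs (λ d e → ¬ R d e) ds →
    length (filter (¬? ∘ R? x) ds) ℕ.+ 𝟙 (does (any? (R? x) ds)) ≡ length ds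
  length-filter-≁ x [] = refl
  length-filter-≁ x {d ∷ ds} (d≁ds ∷ ds!) with R? x d
  ... | no  _   = cong suc (length-filter-≁ x ds!)
  ... | yes x∼d = trans
    (cong (ℕ._+ 1) (cong length (List.filter-all (¬? ∘ R? x)
      (All.map (λ d≁e x∼e → d≁e (R.trans (R.sym x∼d) x∼e)) d≁ds))))
    (ℕ.+-comm (length ds) 1)

  deduplicate-≁ : ∀ xs → AllPairs (λ d e → ¬ R d e) (deduplicate R? xs)
  deduplicate-≁ []       = []
  deduplicate-≁ (x ∷ xs) =
    All.all-filter (¬? ∘ R? x) (deduplicate R? xs) ∷ AllPairs.filter⁺ (¬? ∘ R? x) (deduplicate-≁ xs)

  -- `deduplicate` always keeps the head and removes the representative of its class from the tail,
  -- if there is one; so the count grows only for a new class.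
  classes-∷ : ∀ x xs → length (deduplicate R? (x ∷ xs)) ≡
                       𝟙 (not (does (any? (R? x) xs))) ℕ.+ length (deduplicate R? xs)
  classes-∷ x xs with length-filter-≁ x (deduplicate-≁ xs)
  ... | eq rewrite does-⇔ (mk⇔ (Any.deduplicate⁻ R?)
                              (Any.deduplicate⁺ R? λ e∼d x∼d → R.trans x∼d (R.sym e∼d)))
                          (any? (R? x) (deduplicate R? xs)) (any? (R? x) xs)
      with does (any? (R? x) xs)
  ... | true  = trans (ℕ.+-comm 1 _) eq
  ... | false = cong suc (trans (sym (ℕ.+-identityʳ _)) eq)

module _ {R S : Rel A Level.zero} (R? : Decidable R) (S? : Decidable S)
         (R-eq : IsEquivalence R) (S-eq : IsEquivalence S) where

  private module R = IsEquivalence R-eq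

  classes-cong : (∀ {x y} → R x y ⇔ S x y) →
                 ∀ xs → length (deduplicate R? xs) ≡ length (deduplicate S? xs)
  classes-cong R⇔S []       = refl
  classes-cong R⇔S (x ∷ xs)
    rewrite classes-∷ R? R-eq x xs | classes-∷ S? S-eq x xs
          | does-⇔ (mk⇔ (Any.map (to R⇔S)) (Any.map (from R⇔S))) (any? (R? x) xs) (any? (S? x) xs)
    = cong (_ ℕ.+_) (classes-cong R⇔S xs)

  module _ {s t : A} (s≁t : ¬ R s t)
           (S⇔ : ∀ {x y} → S x y ⇔ (R x y ⊎ (R x s × R t y) ⊎ (R x t × R s y))) where

    private
      _meets?_ : ∀ u xs → Dec (Any (R u) xs)
      u meets? xs = any? (R? u) xs

      meets-resp : ∀ {u w xs} → R u w → does (u meets? xs) ≡ does (w meets? xs)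
      meets-resp {u} {w} {xs} u∼w = does-⇔
        (mk⇔ (Any.map (R.trans (R.sym u∼w))) (Any.map (R.trans u∼w))) (u meets? xs) (w meets? xs)

      -- The relations to `x` are turned to start at `s` and `t`, so that `classes-merge` need only
      -- branch on `R? s x`, `R? t x` and on which points meet `xs`.
      S-meets : ∀ {x xs} →
        Any (S x) xs ⇔ (Any (R x) xs ⊎ (R s x × Any (R t) xs) ⊎ (R t x × Any (R s) xs))
      S-meets {x} {xs} = mk⇔ ⇒ ⇐
        where
        ⇒ : ∀ {xs} → Any (S x) xs →
            Any (R x) xs ⊎ (R s x × Any (R t) xs) ⊎ (R t x × Any (R s) xs)
        ⇒ (here p)  = Sum.map here (Sum.map (Product.map R.sym here) (Product.map R.sym here)) (to S⇔ p)
        ⇒ (there p) = Sum.map there (Sum.map (Product.map₂ there) (Product.map₂ there)) (⇒ p)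
        ⇐ : Any (R x) xs ⊎ (R s x × Any (R t) xs) ⊎ (R t x × Any (R s) xs) → Any (S x) xs
        ⇐ (inj₁ p)              = Any.map (from S⇔ ∘ inj₁) p
        ⇐ (inj₂ (inj₁ (q , p))) = Any.map (λ r → from S⇔ (inj₂ (inj₁ (R.sym q , r)))) p
        ⇐ (inj₂ (inj₂ (q , p))) = Any.map (λ r → from S⇔ (inj₂ (inj₂ (R.sym q , r)))) p

    -- The classes of s and t become one exactly when both of them occur in xs.
    classes-merge : ∀ xs → length (deduplicate R? xs) ≡
      𝟙 (does (s meets? xs) ∧ does (t meets? xs)) ℕ.+ length (deduplicate S? xs)
    classes-merge [] = refl
    classes-merge (x ∷ xs)
      rewrite classes-∷ R? R-eq x xs | classes-∷ S? S-eq x xs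
            | does-⇔ S-meets (any? (S? x) xs)
                (x meets? xs ⊎-dec ((R? s x ×-dec t meets? xs) ⊎-dec (R? t x ×-dec s meets? xs)))
            | classes-merge xs
      with R? s x | R? t x
    ... | yes s∼x | yes t∼x = contradiction (R.trans s∼x (R.sym t∼x)) s≁t
    ... | yes s∼x | no _
      -- As `x` and `s` share a class, they meet `xs` alike, and a truth table in two variables
      -- remains.
      rewrite sym (meets-resp {xs = xs} s∼x)
      with does (s meets? xs) | does (t meets? xs)
    ... | true  | true  = refl
    ... | true  | false = refl
    ... | false | true  = refl
    ... | false | false = refl
    classes-merge (x ∷ xs) | no _ | yes t∼x
      rewrite sym (meets-resp {xs = xs} t∼x)
      with does (s meets? xs) | does (t meets? xs)
    ... | true  | true  = refl
    ... | true  | false = refl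
    ... | false | true  = refl
    ... | false | false = refl
    classes-merge (x ∷ xs) | no _ | no _
      with does (x meets? xs) | does (s meets? xs) | does (t meets? xs)
    ... | true  | true  | true  = refl
    ... | true  | true  | false = refl
    ... | true  | false | true  = refl
    ... | true  | false | false = refl
    ... | false | true  | true  = refl
    ... | false | true  | false = refl
    ... | false | false | true  = refl
    ... | false | false | false = refl

-- Rank

module _ {v : ℕ} where

  conn : Graph v → Fin v → Fin v → Bool
  conn H u w = does (connected? H u w)

  connected-isEquivalence : (H : Graph v) → IsEquivalence (Connected H)
  connected-isEquivalence H = EqC.isEquivalence (λ u w → (u , w) ∈ H)

  edge-connected : ∀ {H : Graph v} {s t} → (s , t) ∈ H → Connected H s t
  edge-connected e∈H = EqC.return e∈H

  connected-sym : ∀ {H : Graph v} {s t} → Connected H s t → Connected H t s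
  connected-sym {H} = EqC.symmetric (λ u w → (u , w) ∈ H)

  connected-bind : ∀ {H K : Graph v} → (∀ {s t} → (s , t) ∈ H → Connected K s t) →
                   ∀ {u w} → Connected H u w → Connected K u w
  connected-bind {K = K} f = EqC.fold (connected-isEquivalence K) f

  connected-⊆ : ∀ {H K : Graph v} → (∀ {e} → e ∈ H → e ∈ K) →
                ∀ {u w} → Connected H u w → Connected K u w
  connected-⊆ H⊆K = EqC.map H⊆K

  connected-∷ : ∀ {H : Graph v} {s t u w} → Connected ((s , t) ∷ H) u w ⇔
    (Connected H u w ⊎ (Connected H u s × Connected H t w) ⊎ (Connected H u t × Connected H s w))
  -- `connected?` decides the right-hand side, so both decisions have the same `does`.
  connected-∷ {H} {s} {t} {u} {w} = mk⇔
    (λ p → dec-true⁻ via? (dec-true (connected? ((s , t) ∷ H) u w) p))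
    (λ p → dec-true⁻ (connected? ((s , t) ∷ H) u w) (dec-true via? p))
    where
    via? = connected? H u w
      ⊎-dec ((connected? H u s ×-dec connected? H t w)
      ⊎-dec (connected? H u t ×-dec connected? H s w))

  -- The size of the spanning forest that a greedy pass from the end of the list builds.
  rank : Graph v → ℕ
  rank []            = 0
  rank ((s , t) ∷ H) = 𝟙 (not (conn H s t)) ℕ.+ rank H

  -- An edge inside a component leaves the relation as it is; an edge between two components merges
  -- two classes, both of which occur in `allFin v`.
  k-∷ : ∀ s t H → k H ≡ 𝟙 (not (conn H s t)) ℕ.+ k ((s , t) ∷ H)
  k-∷ s t H with connected? H s t
  ... | yes s∼t = classes-cong (connected? H) (connected? ((s , t) ∷ H))
        (connected-isEquivalence H) (connected-isEquivalence ((s , t) ∷ H))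
        (mk⇔ (connected-⊆ there)
             (connected-bind λ { (here refl) → s∼t ; (there i) → edge-connected i }))
        (allFin v)
  ... | no  s≁t = trans
        (classes-merge (connected? H) (connected? ((s , t) ∷ H))
          (connected-isEquivalence H) (connected-isEquivalence ((s , t) ∷ H))
          s≁t connected-∷ (allFin v))
        (cong (λ c → 𝟙 c ℕ.+ k ((s , t) ∷ H)) (cong₂ _∧_ (meets s) (meets t)))
    where
    meets : ∀ u → does (any? (connected? H u) (allFin v)) ≡ true
    meets u = dec-true (any? (connected? H u) (allFin v))
                       (Any.tabulate⁺ u ε)

  connected-[] : ∀ {u w : Fin v} → Connected [] u w → u ≡ w
  connected-[] ε            = refl
  connected-[] (fwd () ◅ _)
  connected-[] (bwd () ◅ _)

  k-[] : k {v} [] ≡ v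
  k-[] = trans (cong length (go (Unique.allFin⁺ v))) (List.length-tabulate id)
    where
    go : ∀ {us} → AllPairs _≢_ us → deduplicate (connected? []) us ≡ us
    go []                = refl
    go {u ∷ _} (u∉ ∷ us!) = cong (u ∷_) (trans
      (cong (filter (¬? ∘ connected? [] u)) (go us!))
      (List.filter-all (¬? ∘ connected? [] u) (All.map (_∘ connected-[]) u∉)))

  -- What an edge adds to the rank it takes from the number of components.
  rank+k : ∀ H → rank H ℕ.+ k H ≡ v
  rank+k []            = k-[]
  rank+k ((s , t) ∷ H) = begin
    c ℕ.+ rank H ℕ.+ k ((s , t) ∷ H)   ≡⟨ cong (ℕ._+ k ((s , t) ∷ H)) (ℕ.+-comm c (rank H)) ⟩
    rank H ℕ.+ c ℕ.+ k ((s , t) ∷ H)   ≡⟨ ℕ.+-assoc (rank H) c _ ⟩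
    rank H ℕ.+ (c ℕ.+ k ((s , t) ∷ H)) ≡⟨ cong (rank H ℕ.+_) (sym (k-∷ s t H)) ⟩
    rank H ℕ.+ k H                     ≡⟨ rank+k H ⟩
    v                                  ∎
    where
    open ≡-Reasoning
    c = 𝟙 (not (conn H s t))

  -- The recursion of `rank` follows the order of the edges, but by `rank+k` its value is determined
  -- by the components alone.
  rank-cong : ∀ {H K} → (∀ {u w} → Connected H u w ⇔ Connected K u w) → rank H ≡ rank K
  rank-cong {H} {K} H⇔K = ℕ.+-cancelʳ-≡ (k H) (rank H) (rank K) (begin
    rank H ℕ.+ k H ≡⟨ rank+k H ⟩
    v              ≡⟨ sym (rank+k K) ⟩
    rank K ℕ.+ k K ≡⟨ cong (rank K ℕ.+_) (sym kH≡kK) ⟩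
    rank K ℕ.+ k H ∎)
    where
    open ≡-Reasoning
    kH≡kK = classes-cong (connected? H) (connected? K)
      (connected-isEquivalence H) (connected-isEquivalence K) H⇔K (allFin v)

  rank-⊆ : ∀ {H K} → (∀ {e} → e ∈ H → e ∈ K) → (∀ {e} → e ∈ K → e ∈ H) → rank H ≡ rank K
  rank-⊆ H⊆K K⊆H = rank-cong (mk⇔ (connected-⊆ H⊆K) (connected-⊆ K⊆H))

  rank≤length : ∀ H → rank H ≤ length H
  rank≤length []            = z≤n
  rank≤length ((s , t) ∷ H) = ℕ.+-mono-≤ (𝟙≤1 (not (conn H s t))) (rank≤length H)
    where
    𝟙≤1 : ∀ c → 𝟙 c ≤ 1
    𝟙≤1 true  = ℕ.≤-refl
    𝟙≤1 false = z≤n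

-- There is at least one component: `deduplicate` keeps the head of `allFin (suc v)`, so `k H`
-- unfolds to a successor.
rank≤ : ∀ {v} (H : Graph (suc v)) → rank H ≤ v
rank≤ {v} H = ℕ.≤-pred (subst (suc (rank H) ≤_) (rank+k H)
  (subst (_≤ rank H ℕ.+ k H) (ℕ.+-comm (rank H) 1) (ℕ.+-monoʳ-≤ (rank H) (s≤s z≤n))))

-- Gluing along two vertices

image : ∀ {v w} → (Fin v → Fin w) → Graph v → Graph w
image f = map (Product.map f f)

edge : ∀ {v} → Bool → Fin v → Fin v → Graph v
edge true  s t = (s , t) ∷ []
edge false s t = []

module _ {v w} (f : Fin v → Fin w) where

  image-connected : ∀ {H K u z} → Connected H u z → Connected (image f H ++ K) (f u) (f z)
  image-connected {H} {K} = EqC.gmap f λ e∈H → ∈-++⁺ˡ (∈-map⁺ (Product.map f f) e∈H)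

  -- A path in f(H) ∪ K between points of f is cut at its edges in f(H): the pieces in
  -- between are K-paths whose ends lie in the image of f.
  pull-back : ∀ {H K L} → (∀ {s t} → (s , t) ∈ H → Connected L s t) →
              (∀ {s t} → Connected K (f s) (f t) → Connected L s t) →
              ∀ {u z} → Connected (image f H ++ K) (f u) (f z) → Connected L u z
  pull-back {H} {K} {L} H⊆L K⊆L p = go ε ε p
    where
    go : ∀ {u u′ y z} → Connected L u u′ → Connected K (f u′) y →
         Connected (image f H ++ K) y (f z) → Connected L u z
    go l k ε = l ◅◅ K⊆L k
    go l k (fwd e∈ ◅ p) with ∈-++⁻ (image f H) e∈
    ... | inj₂ e∈K = go l (k ◅◅ (fwd e∈K ◅ ε)) p
    ... | inj₁ e∈H with ∈-map⁻ (Product.map f f) e∈H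
    ...   | (s , t) , st∈H , refl = go (l ◅◅ K⊆L k ◅◅ H⊆L st∈H) ε p
    go l k (bwd e∈ ◅ p) with ∈-++⁻ (image f H) e∈
    ... | inj₂ e∈K = go l (k ◅◅ (bwd e∈K ◅ ε)) p
    ... | inj₁ e∈H with ∈-map⁻ (Product.map f f) e∈H
    ...   | (s , t) , st∈H , refl = go (l ◅◅ K⊆L k ◅◅ connected-sym (H⊆L st∈H)) ε p

rank-edge : ∀ {v} (H : Graph v) c s t →
            rank (edge c s t ++ H) ≡ 𝟙 (c ∧ not (conn H s t)) ℕ.+ rank H
rank-edge H true  s t = refl
rank-edge H false s t = refl

rank-shift : ∀ {v} (H K L : Graph v) → rank (H ++ (K ++ L)) ≡ rank (K ++ (H ++ L))
rank-shift H K L = rank-⊆ (shift H K) (shift K H)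
  where
  shift : ∀ H K {e} → e ∈ H ++ (K ++ L) → e ∈ K ++ (H ++ L)
  shift H K e∈ = [ ∈-++⁺ʳ K ∘ ∈-++⁺ˡ , [ ∈-++⁺ˡ , ∈-++⁺ʳ K ∘ ∈-++⁺ʳ H ]′ ∘ ∈-++⁻ K ]′ (∈-++⁻ H e∈)

-- K meets the copy f(H) of H at most in the two special vertices.
module _ {m w} (f : Fin (2 ℕ.+ m) → Fin w) (f-injective : ∀ {u z} → f u ≡ f z → u ≡ z)
         {K : Graph w}
         (fresh : All (λ (s , t) → ∀ u → (f (suc (suc u)) ≢ s) × (f (suc (suc u)) ≢ t)) K) where

  -- No edge of `K` ends at an inner vertex of the copy, so a path in `K` from there cannot take a
  -- first step.
  isolated : ∀ {u z} → Connected K (f (suc (suc u))) z → f (suc (suc u)) ≡ z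
  isolated ε               = refl
  isolated {u} (fwd e∈ ◅ _) = contradiction refl (proj₁ (All.lookup fresh e∈ u))
  isolated {u} (bwd e∈ ◅ _) = contradiction refl (proj₂ (All.lookup fresh e∈ u))

  private
    κ : Bool
    κ = conn K (f X) (f Y)

  -- A path in `K` between two points of the copy has equal ends unless it joins `f X` and `f Y`;
  -- that case is what the edge for `κ` records.
  connected-in-K : ∀ H {u z} → Connected K (f u) (f z) → Connected (edge κ X Y ++ H) u z
  connected-in-K H {u} {z} = go u z
    where
    special : Connected K (f X) (f Y) → Connected (edge κ X Y ++ H) X Y
    special p = subst (λ c → Connected (edge c X Y ++ H) X Y)
      (sym (dec-true (connected? K (f X) (f Y)) p)) (edge-connected (here refl))
    inner : ∀ u z → Connected K (f (suc (suc u))) (f z) → Connected (edge κ X Y ++ H) (suc (suc u)) z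
    inner u z p with f-injective (isolated p)
    ... | refl = ε
    go : ∀ u z → Connected K (f u) (f z) → Connected (edge κ X Y ++ H) u z
    go zero          zero          p = ε
    go (suc zero)    (suc zero)    p = ε
    go zero          (suc zero)    p = special p
    go (suc zero)    zero          p = connected-sym {H = edge κ X Y ++ H} (special (connected-sym {H = K} p))
    go (suc (suc u)) z             p = inner u z p
    go u             (suc (suc z)) p =
      connected-sym {H = edge κ X Y ++ H} (inner z u (connected-sym {H = K} p))

  -- Seen from the copy, the whole of `K` acts as one possible edge between `X` and `Y`.
  connected-image : ∀ H {u z} →
    Connected (image f H ++ K) (f u) (f z) ⇔ Connected (edge κ X Y ++ H) u z
  connected-image H {u} {z} = mk⇔
    (pull-back f (λ e∈H → edge-connected (∈-++⁺ʳ (edge κ X Y) e∈H)) (connected-in-K H))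
    (λ p → go (conn K (f X) (f Y)) refl p)
    where
    HK : ∀ {s t} → (s , t) ∈ H → Connected (image f H ++ K) (f s) (f t)
    HK e∈H = image-connected f (edge-connected e∈H)
    go : ∀ c → conn K (f X) (f Y) ≡ c → Connected (edge c X Y ++ H) u z →
         Connected (image f H ++ K) (f u) (f z)
    go false _  p = image-connected f p
    go true  eq p = EqC.gfold (connected-isEquivalence (image f H ++ K)) f
      (λ { (here refl) → connected-⊆ (∈-++⁺ʳ (image f H)) (dec-true⁻ (connected? K (f X) (f Y)) eq)
         ; (there e∈H) → HK e∈H }) p

  -- Induction on the edges of `H`: by `connected-image` each raises both ranks or neither. The term
  -- `𝟙 κ` balances the edge that is on the right from the start.
  rank-image : ∀ H → rank (image f H ++ K) ℕ.+ 𝟙 κ ≡ rank K ℕ.+ rank (edge κ X Y ++ H)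
  rank-image []            = cong (rank K ℕ.+_) (go κ)
    where
    go : ∀ c → 𝟙 c ≡ rank {2 ℕ.+ m} (edge c X Y ++ [])
    go true  = refl
    go false = refl
  rank-image ((s , t) ∷ H) = begin
    𝟙 (not (conn (image f H ++ K) (f s) (f t))) ℕ.+ rank (image f H ++ K) ℕ.+ 𝟙 κ
      ≡⟨ ℕ.+-assoc d (rank (image f H ++ K)) (𝟙 κ) ⟩
    d ℕ.+ (rank (image f H ++ K) ℕ.+ 𝟙 κ)
      ≡⟨ cong₂ ℕ._+_ (cong (𝟙 ∘ not) (does-⇔ (connected-image H)
           (connected? (image f H ++ K) (f s) (f t)) (connected? (edge κ X Y ++ H) s t)))
           (rank-image H) ⟩
    d′ ℕ.+ (rank K ℕ.+ rank (edge κ X Y ++ H))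
      ≡⟨ sym (ℕ.+-assoc d′ (rank K) _) ⟩
    d′ ℕ.+ rank K ℕ.+ rank (edge κ X Y ++ H)
      ≡⟨ cong (ℕ._+ rank (edge κ X Y ++ H)) (ℕ.+-comm d′ (rank K)) ⟩
    rank K ℕ.+ d′ ℕ.+ rank (edge κ X Y ++ H)
      ≡⟨ ℕ.+-assoc (rank K) d′ _ ⟩
    rank K ℕ.+ rank ((s , t) ∷ edge κ X Y ++ H)
      ≡⟨ cong (rank K ℕ.+_) (rank-shift ((s , t) ∷ []) (edge κ X Y) H) ⟩
    rank K ℕ.+ rank (edge κ X Y ++ (s , t) ∷ H) ∎
    where
    open ≡-Reasoning
    d  = 𝟙 (not (conn (image f H ++ K) (f s) (f t)))
    d′ = 𝟙 (not (conn (edge κ X Y ++ H) s t))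

  -- By `rank-image` the glued rank is `rank H` plus `rank K`, less one if both graphs join the
  -- special vertices. It depends on `H` only through `rank H` and `conn H X Y`, so an edge can
  -- stand in for `H`.
  rank-replace : ∀ H → rank (image f H ++ K) ℕ.+ 𝟙 (conn H X Y) ≡
                       rank H ℕ.+ rank (edge (conn H X Y) (f X) (f Y) ++ K)
  rank-replace H with rank-image H
  ... | eq rewrite rank-edge H κ X Y | rank-edge K (conn H X Y) (f X) (f Y)
      with conn K (f X) (f Y) | conn H X Y
  ... | true  | true  = trans eq (ℕ.+-comm (rank K) (rank H))
  ... | true  | false = ℕ.suc-injective (begin
    suc (rank (image f H ++ K) ℕ.+ 0) ≡⟨ sym (ℕ.+-suc _ 0) ⟩
    rank (image f H ++ K) ℕ.+ 1       ≡⟨ eq ⟩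
    rank K ℕ.+ suc (rank H)           ≡⟨ ℕ.+-comm (rank K) (suc (rank H)) ⟩
    suc (rank H ℕ.+ rank K)           ∎)
    where open ≡-Reasoning
  ... | false | true  = begin
    rank (image f H ++ K) ℕ.+ 1       ≡⟨ ℕ.+-suc _ 0 ⟩
    suc (rank (image f H ++ K) ℕ.+ 0) ≡⟨ cong suc eq ⟩
    suc (rank K ℕ.+ rank H)           ≡⟨ ℕ.+-comm (suc (rank K)) (rank H) ⟩
    rank H ℕ.+ suc (rank K)           ∎
    where open ≡-Reasoning
  ... | false | false = trans eq (ℕ.+-comm (rank K) (rank H))

-- Gluing four copies

length-edge : ∀ {v} c {s t : Fin v} → length (edge c s t) ≡ 𝟙 c
length-edge true  = refl
length-edge false = refl

module _ (m : ℕ) where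

  -- Sides of the 4-cycle `X`, `a`, `Y`, `b`; the `i`-th copy is glued in along the `i`-th side.
  bridges : (Fin 4 → Bool) → List (Fin 4) → Graph (4 ℕ.+ 4 ℕ.* m)
  bridges c = concatMap λ i → edge (c i) (glue {m} i X) (glue {m} i Y)

  length-bridges : ∀ c is → length (bridges c is) ≡ sum (map (𝟙 ∘ c) is)
  length-bridges c []       = refl
  length-bridges c (i ∷ is) =
    trans (List.length-++ (edge (c i) (glue {m} i X) (glue {m} i Y)))
      (cong₂ ℕ._+_ (length-edge (c i)) (length-bridges c is))

module _ {m : ℕ} where

  -- One of `X`, `Y`, `a`, `b`, put negatively because it serves to tell these apart from inner
  -- vertices.
  Terminal : Fin (4 ℕ.+ 4 ℕ.* m) → Set
  Terminal z = ∀ w → 4 ↑ʳ w ≢ z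

  glue-X : ∀ i → Terminal (glue {m} i X)
  glue-X 0F _ ()
  glue-X 1F _ ()
  glue-X 2F _ ()
  glue-X 3F _ ()

  glue-Y : ∀ i → Terminal (glue {m} i Y)
  glue-Y 0F _ ()
  glue-Y 1F _ ()
  glue-Y 2F _ ()
  glue-Y 3F _ ()

  glue-X≢Y : ∀ i → glue {m} i X ≢ glue {m} i Y
  glue-X≢Y 0F ()
  glue-X≢Y 1F ()
  glue-X≢Y 2F ()
  glue-X≢Y 3F ()

  -- The catch-all clause of `glue` reduces only for a concrete `i`, since the clauses before it
  -- match on that index.
  glue-inner : ∀ i u → glue {m} i (suc (suc u)) ≡ 4 ↑ʳ combine i u
  glue-inner 0F u = refl
  glue-inner 1F u = refl
  glue-inner 2F u = refl
  glue-inner 3F u = refl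

  inner-≢-terminal : ∀ i u {z} → Terminal z → glue {m} i (suc (suc u)) ≢ z
  inner-≢-terminal i u t eq = t (combine i u) (trans (sym (glue-inner i u)) eq)

  inner-≡ : ∀ i j (u : Fin m) w → glue {m} i (suc (suc u)) ≡ glue {m} j (suc (suc w)) →
            combine i u ≡ combine j w
  inner-≡ i j u w eq =
    Fin.↑ʳ-injective 4 _ _ (trans (sym (glue-inner i u)) (trans eq (glue-inner j w)))

  glue-injective : ∀ i {u w} → glue {m} i u ≡ glue {m} i w → u ≡ w
  glue-injective i {zero}        {zero}        eq = refl
  glue-injective i {zero}        {suc zero}    eq = contradiction eq (glue-X≢Y i)
  glue-injective i {suc zero}    {zero}        eq = contradiction (sym eq) (glue-X≢Y i)
  glue-injective i {suc zero}    {suc zero}    eq = refl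
  glue-injective i {zero}        {suc (suc w)} eq = contradiction (sym eq) (inner-≢-terminal i w (glue-X i))
  glue-injective i {suc zero}    {suc (suc w)} eq = contradiction (sym eq) (inner-≢-terminal i w (glue-Y i))
  glue-injective i {suc (suc u)} {zero}        eq = contradiction eq (inner-≢-terminal i u (glue-X i))
  glue-injective i {suc (suc u)} {suc zero}    eq = contradiction eq (inner-≢-terminal i u (glue-Y i))
  glue-injective i {suc (suc u)} {suc (suc w)} eq =
    cong (λ z → suc (suc z)) (Fin.combine-injectiveʳ i u i w (inner-≡ i i u w eq))

  inner-disjoint : ∀ {i j} → i ≢ j → ∀ (u : Fin m) w → glue {m} i (suc (suc u)) ≢ glue {m} j w
  inner-disjoint {i} {j} i≢j u zero          eq = inner-≢-terminal i u (glue-X j) eq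
  inner-disjoint {i} {j} i≢j u (suc zero)    eq = inner-≢-terminal i u (glue-Y j) eq
  inner-disjoint {i} {j} i≢j u (suc (suc w)) eq =
    i≢j (Fin.combine-injectiveˡ i u j w (inner-≡ i j u w eq))

  OnTerminals : Graph (4 ℕ.+ 4 ℕ.* m) → Set
  OnTerminals = All (λ (s , t) → Terminal s × Terminal t)

  edge-terminal : ∀ c {s t} → Terminal s → Terminal t → OnTerminals (edge c s t)
  edge-terminal true  s t = (s , t) ∷ []
  edge-terminal false s t = []

  copies : (Fin 4 → Graph (2 ℕ.+ m)) → List (Fin 4) → Graph (4 ℕ.+ 4 ℕ.* m)
  copies H = concatMap λ i → image (glue {m} i) (H i)

  module _ (H : Fin 4 → Graph (2 ℕ.+ m)) where

    joins : Fin 4 → Bool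
    joins i = conn (H i) X Y

    -- Copies turn into edges one at a time by `rank-replace`, and the edges obtained collect in
    -- `E`. As these touch terminals only, and distinct copies share no inner vertices, the next
    -- copy meets the rest at most in its special vertices.
    rank-copies : ∀ {is} → AllPairs _≢_ is → ∀ E → OnTerminals E →
      rank (E ++ copies H is) ℕ.+ sum (map (𝟙 ∘ joins) is) ≡
      sum (map (rank ∘ H) is) ℕ.+ rank (E ++ bridges m joins is)
    rank-copies [] E _ = ℕ.+-identityʳ _
    rank-copies {i ∷ is} (i∉is ∷ is!) E E-term = begin
      rank (E ++ (copy ++ copies H is)) ℕ.+ (c ℕ.+ C)
        ≡⟨ cong (ℕ._+ (c ℕ.+ C)) (rank-shift E copy (copies H is)) ⟩
      rank (copy ++ (E ++ copies H is)) ℕ.+ (c ℕ.+ C)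
        ≡⟨ sym (ℕ.+-assoc _ c C) ⟩
      rank (copy ++ (E ++ copies H is)) ℕ.+ c ℕ.+ C
        ≡⟨ cong (ℕ._+ C) (rank-replace (glue {m} i) (glue-injective i) fresh (H i)) ⟩
      rank (H i) ℕ.+ rank (bridge ++ (E ++ copies H is)) ℕ.+ C
        ≡⟨ ℕ.+-assoc (rank (H i)) _ C ⟩
      rank (H i) ℕ.+ (rank (bridge ++ (E ++ copies H is)) ℕ.+ C)
        ≡⟨ cong (λ L → rank (H i) ℕ.+ (rank L ℕ.+ C)) (sym (List.++-assoc bridge E (copies H is))) ⟩
      rank (H i) ℕ.+ (rank ((bridge ++ E) ++ copies H is) ℕ.+ C)
        ≡⟨ cong (rank (H i) ℕ.+_) (rank-copies is! (bridge ++ E) (All.++⁺ bridge-term E-term)) ⟩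
      rank (H i) ℕ.+ (R ℕ.+ rank ((bridge ++ E) ++ bridges m joins is))
        ≡⟨ sym (ℕ.+-assoc (rank (H i)) R _) ⟩
      rank (H i) ℕ.+ R ℕ.+ rank ((bridge ++ E) ++ bridges m joins is)
        ≡⟨ cong (λ L → rank (H i) ℕ.+ R ℕ.+ rank L) (List.++-assoc bridge E (bridges m joins is)) ⟩
      rank (H i) ℕ.+ R ℕ.+ rank (bridge ++ (E ++ bridges m joins is))
        ≡⟨ cong (rank (H i) ℕ.+ R ℕ.+_) (rank-shift bridge E (bridges m joins is)) ⟩
      rank (H i) ℕ.+ R ℕ.+ rank (E ++ (bridge ++ bridges m joins is)) ∎
      where
      open ≡-Reasoning
      copy   = image (glue {m} i) (H i)
      bridge = edge (joins i) (glue {m} i X) (glue {m} i Y)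
      c = 𝟙 (joins i)
      C = sum (map (𝟙 ∘ joins) is)
      R = sum (map (rank ∘ H) is)
      bridge-term : OnTerminals bridge
      bridge-term = edge-terminal (joins i) (glue-X i) (glue-Y i)
      fresh : All (λ (s , t) → ∀ u → (glue {m} i (suc (suc u)) ≢ s) × (glue {m} i (suc (suc u)) ≢ t))
                  (E ++ copies H is)
      fresh = All.++⁺
        (All.map (λ (s , t) u → inner-≢-terminal i u s , inner-≢-terminal i u t) E-term)
        (All.concat⁺ (All.map⁺ (All.map (λ i≢j → All.map⁺ (All.universal
          (λ (s , t) u → inner-disjoint i≢j u s , inner-disjoint i≢j u t) _)) i∉is)))

    length-copies : ∀ is → length (copies H is) ≡ sum (map (length ∘ H) is)
    length-copies []       = refl
    length-copies (i ∷ is) = trans (List.length-++ (image (glue {m} i) (H i)))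
      (cong₂ ℕ._+_ (List.length-map _ (H i)) (length-copies is))

-- Exponents of the glued graph

sum-map-+ : ∀ {f g h : A → ℕ} {c} → (∀ i → f i ℕ.+ g i ≡ c ℕ.+ h i) → ∀ is →
            sum (map f is) ℕ.+ sum (map g is) ≡ length is ℕ.* c ℕ.+ sum (map h is)
sum-map-+ eq [] = refl
sum-map-+ {f = f} {g} {h} {c} eq (i ∷ is) = begin
  f i ℕ.+ F ℕ.+ (g i ℕ.+ G′)               ≡⟨ interchange (f i) F (g i) G′ ⟩
  (f i ℕ.+ g i) ℕ.+ (F ℕ.+ G′)             ≡⟨ cong₂ ℕ._+_ (eq i) (sum-map-+ eq is) ⟩
  c ℕ.+ h i ℕ.+ (length is ℕ.* c ℕ.+ H)    ≡⟨ interchange c (h i) (length is ℕ.* c) H ⟩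
  c ℕ.+ length is ℕ.* c ℕ.+ (h i ℕ.+ H)    ∎
  where
  open ≡-Reasoning
  interchange = +-*-Solver.solve 4 (λ a b c d → a :+ b :+ (c :+ d) := a :+ c :+ (b :+ d)) refl
    where open +-*-Solver
  F  = sum (map f is)
  G′ = sum (map g is)
  H  = sum (map h is)

𝟙-not-injective : ∀ c d → 𝟙 (not c) ≡ 𝟙 (not d) → c ≡ d
𝟙-not-injective true  true  _ = refl
𝟙-not-injective false false _ = refl

-- For a spanning subgraph H of G n, this is the exponent of x - 1 in the weight of H if H
-- joins X and Y, and one less than that exponent otherwise: it is the exponent in N.
corank : ∀ {m} → Graph (2 ℕ.+ m) → ℕ
corank {m} H = suc m ∸ rank ((X , Y) ∷ H)

defect : ∀ {v} → Graph v → ℕ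
defect H = length H ∸ rank H

defect+rank : ∀ {v} (H : Graph v) → defect H ℕ.+ rank H ≡ length H
defect+rank H = ℕ.m∸n+n≡m (rank≤length H)

-- The edge `(X , Y)` raises the rank exactly if `H` separates its ends; hence the indicator. Summed
-- over the copies, the indicators match those in `rank-glued⁺`.
corank+rank : ∀ {m} (H : Graph (2 ℕ.+ m)) → corank H ℕ.+ rank H ≡ m ℕ.+ 𝟙 (conn H X Y)
corank+rank {m} H with ℕ.m∸n+n≡m (rank≤ ((X , Y) ∷ H))
... | eq with conn H X Y
...   | true  = trans eq (ℕ.+-comm 1 m)
...   | false = trans (ℕ.suc-injective (trans (sym (ℕ.+-suc _ (rank H))) eq)) (sym (ℕ.+-identityʳ m))

-- A truth table condensed into one Boolean, so that finitely many cases are checked by evaluation.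
all-Bool : ∀ n → (Vec Bool n → Bool) → Bool
all-Bool zero    P = P []
all-Bool (suc n) P = all-Bool n (λ bs → P (true ∷ bs)) ∧ all-Bool n (λ bs → P (false ∷ bs))

all-Bool-sound : ∀ n {P} → Bool.T (all-Bool n P) → ∀ bs → Bool.T (P bs)
all-Bool-sound zero    p []           = p
all-Bool-sound (suc n) p (true  ∷ bs) = all-Bool-sound n (proj₁ (to T-∧ p)) bs
all-Bool-sound (suc n) p (false ∷ bs) = all-Bool-sound n (proj₂ (to T-∧ p)) bs

four : A → A → A → A → Fin 4 → A
four h₀ h₁ h₂ h₃ 0F = h₀
four h₀ h₁ h₂ h₃ 1F = h₁
four h₀ h₁ h₂ h₃ 2F = h₂
four h₀ h₁ h₂ h₃ 3F = h₃

module _ (m : ℕ) where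

  -- The subgraph of the diamond that remains when the i-th copy is replaced by an edge if
  -- c i, and by nothing otherwise; e says whether the edge ab is present.
  shape : Bool → (Fin 4 → Bool) → Graph (4 ℕ.+ 4 ℕ.* m)
  shape e c = edge e a b ++ bridges m c (allFin 4)

  -- The `3` is one less than the number of terminals: the inner vertices, isolated in a shape, are
  -- left out of the count.
  shape-corank : Bool → (Fin 4 → Bool) → ℕ
  shape-corank e c = 3 ∸ rank ((X , Y) ∷ shape e c)

  -- Evaluation over the 32 shapes; connectivity among the first four vertices computes with `m` a
  -- variable. A shape uses `c` only at the four indices, so `c` may be tabulated.
  rank-shape≤3 : ∀ e c → rank ((X , Y) ∷ shape e c) ≤ 3
  rank-shape≤3 e c = ℕ.≤ᵇ⇒≤ _ _ (all-Bool-sound 5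
    {λ { (e ∷ c₀ ∷ c₁ ∷ c₂ ∷ c₃ ∷ []) → rank ((X , Y) ∷ shape e (four c₀ c₁ c₂ c₃)) ≤ᵇ 3 }} tt
    (e ∷ c 0F ∷ c 1F ∷ c 2F ∷ c 3F ∷ []))

module _ {m : ℕ} where

  glued : Bool → (Fin 4 → Graph (2 ℕ.+ m)) → Graph (4 ℕ.+ 4 ℕ.* m)
  glued e H = edge e a b ++ copies H (allFin 4)

  module _ (e : Bool) (H : Fin 4 → Graph (2 ℕ.+ m)) where

    private
      c : Fin 4 → Bool
      c = joins H

      S : (Fin 4 → ℕ) → ℕ
      S f = sum (map f (allFin 4))

    rank-glued : rank (glued e H) ℕ.+ S (𝟙 ∘ c) ≡ S (rank ∘ H) ℕ.+ rank (shape m e c)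
    rank-glued = rank-copies H (Unique.allFin⁺ 4) (edge e a b)
      (edge-terminal {m} e (λ _ ()) (λ _ ()))

    rank-glued⁺ : rank ((X , Y) ∷ glued e H) ℕ.+ S (𝟙 ∘ c) ≡
                  S (rank ∘ H) ℕ.+ rank ((X , Y) ∷ shape m e c)
    rank-glued⁺ = rank-copies H (Unique.allFin⁺ 4) ((X , Y) ∷ edge e a b)
      (((λ _ ()) , (λ _ ())) ∷ edge-terminal {m} e (λ _ ()) (λ _ ()))

    -- Whether `X` and `Y` are joined shows in the ranks with and without the edge `(X , Y)`: the
    -- difference of `rank-glued⁺` and `rank-glued` leaves the two indicators.
    conn-glued : conn (glued e H) X Y ≡ conn (shape m e c) X Y
    conn-glued = 𝟙-not-injective _ _ (ℕ.+-cancelʳ-≡ (rank (glued e H) ℕ.+ S (𝟙 ∘ c)) d d′ (begin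
      d ℕ.+ (rank (glued e H) ℕ.+ S (𝟙 ∘ c))     ≡⟨ sym (ℕ.+-assoc d _ _) ⟩
      d ℕ.+ rank (glued e H) ℕ.+ S (𝟙 ∘ c)       ≡⟨ rank-glued⁺ ⟩
      S (rank ∘ H) ℕ.+ (d′ ℕ.+ rank (shape m e c)) ≡⟨ swap (S (rank ∘ H)) d′ (rank (shape m e c)) ⟩
      d′ ℕ.+ (S (rank ∘ H) ℕ.+ rank (shape m e c)) ≡⟨ cong (d′ ℕ.+_) (sym rank-glued) ⟩
      d′ ℕ.+ (rank (glued e H) ℕ.+ S (𝟙 ∘ c))    ∎))
      where
      open ≡-Reasoning
      d  = 𝟙 (not (conn (glued e H) X Y))
      d′ = 𝟙 (not (conn (shape m e c) X Y))
      swap = +-*-Solver.solve 3 (λ a b c → a :+ (b :+ c) := b :+ (a :+ c)) refl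
        where open +-*-Solver

    -- The vertex count splits as `3 + 4 * m`, and the indicators from `corank+rank` cancel those
    -- from `rank-glued⁺`. Adding the ranks to both sides avoids truncated subtraction.
    corank-glued : corank (glued e H) ≡ S (corank ∘ H) ℕ.+ shape-corank m e c
    corank-glued = ℕ.+-cancelʳ-≡ (R⁺ ℕ.+ S (𝟙 ∘ c)) _ _ (begin
      corank (glued e H) ℕ.+ (R⁺ ℕ.+ S (𝟙 ∘ c))
        ≡⟨ sym (ℕ.+-assoc (corank (glued e H)) R⁺ _) ⟩
      corank (glued e H) ℕ.+ R⁺ ℕ.+ S (𝟙 ∘ c)
        ≡⟨ cong (ℕ._+ S (𝟙 ∘ c)) (ℕ.m∸n+n≡m (rank≤ ((X , Y) ∷ glued e H))) ⟩
      3 ℕ.+ 4 ℕ.* m ℕ.+ S (𝟙 ∘ c)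
        ≡⟨ ℕ.+-assoc 3 (4 ℕ.* m) _ ⟩
      3 ℕ.+ (4 ℕ.* m ℕ.+ S (𝟙 ∘ c))
        ≡⟨ cong₂ ℕ._+_ (sym (ℕ.m∸n+n≡m (rank-shape≤3 m e c)))
             (sym (sum-map-+ {f = corank ∘ H} {rank ∘ H} {𝟙 ∘ c} {m}
               (λ i → corank+rank (H i)) (allFin 4))) ⟩
      shape-corank m e c ℕ.+ ρ⁺ ℕ.+ (S (corank ∘ H) ℕ.+ S (rank ∘ H))
        ≡⟨ rearrange (shape-corank m e c) ρ⁺ (S (corank ∘ H)) (S (rank ∘ H)) ⟩
      S (corank ∘ H) ℕ.+ shape-corank m e c ℕ.+ (S (rank ∘ H) ℕ.+ ρ⁺)
        ≡⟨ cong (S (corank ∘ H) ℕ.+ shape-corank m e c ℕ.+_) (sym rank-glued⁺) ⟩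
      S (corank ∘ H) ℕ.+ shape-corank m e c ℕ.+ (R⁺ ℕ.+ S (𝟙 ∘ c)) ∎)
      where
      open ≡-Reasoning
      R⁺ = rank ((X , Y) ∷ glued e H)
      ρ⁺ = rank ((X , Y) ∷ shape m e c)
      rearrange = +-*-Solver.solve 4 (λ a b c d → a :+ b :+ (c :+ d) := c :+ a :+ (d :+ b)) refl
        where open +-*-Solver

    -- Each joining copy puts one edge into the shape, so the same `S (𝟙 ∘ c)` corrects both the
    -- edge count and the rank.
    defect-glued : defect (glued e H) ≡ S (defect ∘ H) ℕ.+ defect (shape m e c)
    defect-glued = ℕ.+-cancelʳ-≡ (R ℕ.+ S (𝟙 ∘ c)) _ _ (begin
      defect (glued e H) ℕ.+ (R ℕ.+ S (𝟙 ∘ c))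
        ≡⟨ sym (ℕ.+-assoc (defect (glued e H)) R _) ⟩
      defect (glued e H) ℕ.+ R ℕ.+ S (𝟙 ∘ c)
        ≡⟨ cong (ℕ._+ S (𝟙 ∘ c)) (defect+rank (glued e H)) ⟩
      length (glued e H) ℕ.+ S (𝟙 ∘ c)
        ≡⟨ cong (ℕ._+ S (𝟙 ∘ c)) (trans (List.length-++ (edge e a b))
             (cong (E ℕ.+_) (length-copies H (allFin 4)))) ⟩
      E ℕ.+ S (length ∘ H) ℕ.+ S (𝟙 ∘ c)
        ≡⟨ swap (E) (S (length ∘ H)) (S (𝟙 ∘ c)) ⟩
      E ℕ.+ S (𝟙 ∘ c) ℕ.+ S (length ∘ H)
        ≡⟨ cong₂ ℕ._+_ (sym (trans (List.length-++ (edge e a b))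
             (cong (E ℕ.+_) (length-bridges m c (allFin 4))))) lengths ⟩
      length (shape m e c) ℕ.+ (S (defect ∘ H) ℕ.+ S (rank ∘ H))
        ≡⟨ cong (ℕ._+ (S (defect ∘ H) ℕ.+ S (rank ∘ H))) (sym (defect+rank (shape m e c))) ⟩
      defect (shape m e c) ℕ.+ ρ ℕ.+ (S (defect ∘ H) ℕ.+ S (rank ∘ H))
        ≡⟨ rearrange (defect (shape m e c)) ρ (S (defect ∘ H)) (S (rank ∘ H)) ⟩
      S (defect ∘ H) ℕ.+ defect (shape m e c) ℕ.+ (S (rank ∘ H) ℕ.+ ρ)
        ≡⟨ cong (S (defect ∘ H) ℕ.+ defect (shape m e c) ℕ.+_) (sym rank-glued) ⟩
      S (defect ∘ H) ℕ.+ defect (shape m e c) ℕ.+ (R ℕ.+ S (𝟙 ∘ c)) ∎)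
      where
      open ≡-Reasoning
      E = length (edge {4 ℕ.+ 4 ℕ.* m} e a b)
      R = rank (glued e H)
      ρ = rank (shape m e c)
      lengths : S (length ∘ H) ≡ S (defect ∘ H) ℕ.+ S (rank ∘ H)
      lengths = sym (sum-map-+ {f = defect ∘ H} {rank ∘ H} {length ∘ H} {0}
        (λ i → defect+rank (H i)) (allFin 4))
      rearrange = +-*-Solver.solve 4 (λ a b c d → a :+ b :+ (c :+ d) := c :+ a :+ (d :+ b)) refl
        where open +-*-Solver
      swap = +-*-Solver.solve 3 (λ a b c → a :+ b :+ c := a :+ c :+ b) refl
        where open +-*-Solver

-- An extra edge `(X , Y)` cannot raise a rank that is already maximal.
joined : ∀ {m} (H : Graph (2 ℕ.+ m)) → rank H ≡ suc m → conn H X Y ≡ true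
joined {m} H eq with rank≤ ((X , Y) ∷ H)
... | le rewrite eq with conn H X Y
...   | true  = refl
...   | false = contradiction le (ℕ.<-irrefl refl)

-- This is the connectedness of `G n`. In the induction every copy joins its special vertices, so
-- the shape is the whole diamond, of rank 3.
rank-G : ∀ n → rank (G n) ≡ suc (others n)
rank-G zero    = refl
rank-G (suc n) = ℕ.+-cancelʳ-≡ 4 _ _ (begin
  rank (G (suc n)) ℕ.+ 4 ≡⟨ spanning ⟩
  _                      ≡⟨ cong (λ r → r ℕ.+ (r ℕ.+ (r ℕ.+ (r ℕ.+ 0))) ℕ.+ 3) (rank-G n) ⟩
  _                      ≡⟨ arith (others n) ⟩
  3 ℕ.+ 4 ℕ.* others n ℕ.+ 4 ∎)
  where
  open ≡-Reasoning
  spanning : rank (G (suc n)) ℕ.+ 4 ≡ 4 ℕ.* rank (G n) ℕ.+ 3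
  spanning = subst
    (λ c → rank (G (suc n)) ℕ.+ 4 ℕ.* 𝟙 c ≡
           4 ℕ.* rank (G n) ℕ.+ rank (shape (others n) true (λ _ → c)))
    (joined (G n) (rank-G n)) (rank-glued true (λ _ → G n))
  arith = +-*-Solver.solve 1 (λ o → con 4 :* (con 1 :+ o) :+ con 3 := con 3 :+ con 4 :* o :+ con 4) refl
    where open +-*-Solver

-- Sums over spanning subgraphs

-- With `p` and `q` in place of `x - 1` and `y - 1` no subtraction occurs, so a commutative semiring
-- and a solver with natural coefficients suffice.
module Sums {r ℓ} (S : CommutativeSemiring r ℓ) where

  open CommutativeSemiring S
    using (Carrier; _≈_; _+_; _*_; 0#; 1#; setoid; semiring; +-cong; *-cong)
  private module S = CommutativeSemiring S
  open SetoidReasoning setoid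
  open NaturalCoefficients S
    using (solve; _:=_; _:+_; _:*_; con; _:^_; _:×_) renaming (Polynomial to Expr)
  open Exp semiring using (_^_; ^-homo-*; ^-congˡ; ^-congʳ)
  open RawSemiring S.rawSemiring using () renaming (_×_ to infixr 8 _·_)
  open Mult S.+-monoid using (×-congʳ)

  ∑ : List A → (A → Carrier) → Carrier
  ∑ as f = foldr (λ a s → f a + s) 0# as

  ∑-cong : ∀ (as : List A) {f g : A → Carrier} → (∀ a → f a ≈ g a) → ∑ as f ≈ ∑ as g
  ∑-cong []       f≈g = S.refl
  ∑-cong (a ∷ as) f≈g = +-cong (f≈g a) (∑-cong as f≈g)

  ∑-+ : ∀ (as : List A) (f g : A → Carrier) → ∑ as (λ a → f a + g a) ≈ ∑ as f + ∑ as g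
  ∑-+ []       f g = S.sym (S.+-identityˡ 0#)
  ∑-+ (a ∷ as) f g = S.trans (S.+-congˡ (∑-+ as f g))
    (solve 4 (λ x y z w → x :+ y :+ (z :+ w) := x :+ z :+ (y :+ w)) S.refl _ _ _ _)

  ∑-*ˡ : ∀ c (as : List A) f → ∑ as (λ a → c * f a) ≈ c * ∑ as f
  ∑-*ˡ c []       f = S.sym (S.zeroʳ c)
  ∑-*ˡ c (a ∷ as) f = S.trans (S.+-congˡ (∑-*ˡ c as f)) (S.sym (S.distribˡ c _ _))

  ∑-*ʳ : ∀ c (as : List A) f → ∑ as (λ a → f a * c) ≈ ∑ as f * c
  ∑-*ʳ c []       f = S.sym (S.zeroˡ c)
  ∑-*ʳ c (a ∷ as) f = S.trans (S.+-congˡ (∑-*ʳ c as f)) (S.sym (S.distribʳ c _ _))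

  ∑-++ : ∀ (as bs : List A) f → ∑ (as ++ bs) f ≈ ∑ as f + ∑ bs f
  ∑-++ []       bs f = S.sym (S.+-identityˡ _)
  ∑-++ (a ∷ as) bs f = S.trans (S.+-congˡ (∑-++ as bs f)) (S.sym (S.+-assoc _ _ _))

  ∑-map : ∀ (g : A → B) as f → ∑ (map g as) f ≡ ∑ as (f ∘ g)
  ∑-map g []       f = refl
  ∑-map g (a ∷ as) f = cong (f (g a) +_) (∑-map g as f)

  ∑-sublists-∷ : ∀ a (as : List A) f →
    ∑ (sublists (a ∷ as)) f ≈ ∑ (sublists as) f + ∑ (sublists as) (f ∘ (a ∷_))
  ∑-sublists-∷ a as f = S.trans (∑-++ (sublists as) (map (a ∷_) (sublists as)) f)
    (S.+-congˡ (S.reflexive (∑-map (a ∷_) (sublists as) f)))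

  ∑-sublists-map-++ : ∀ (g : A → B) as bs f → ∑ (sublists (map g as ++ bs)) f ≈
    ∑ (sublists as) λ as′ → ∑ (sublists bs) λ bs′ → f (map g as′ ++ bs′)
  ∑-sublists-map-++ g []       bs f = S.sym (S.+-identityʳ _)
  ∑-sublists-map-++ g (a ∷ as) bs f = begin
    ∑ (sublists (g a ∷ map g as ++ bs)) f
      ≈⟨ ∑-sublists-∷ (g a) (map g as ++ bs) f ⟩
    ∑ (sublists (map g as ++ bs)) f + ∑ (sublists (map g as ++ bs)) (f ∘ (g a ∷_))
      ≈⟨ +-cong (∑-sublists-map-++ g as bs f) (∑-sublists-map-++ g as bs (f ∘ (g a ∷_))) ⟩
    ∑ (sublists as) F + ∑ (sublists as) (F ∘ (a ∷_))
      ≈⟨ ∑-sublists-∷ a as F ⟨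
    ∑ (sublists (a ∷ as)) F ∎
    where
    F : List _ → Carrier
    F as′ = ∑ (sublists bs) λ bs′ → f (map g as′ ++ bs′)

  _when_ : Carrier → Bool → Carrier
  w when c = if c then w else 0#

  when-* : ∀ w z c → (w when c) * z ≈ (w * z) when c
  when-* w z true  = S.refl
  when-* w z false = S.zeroˡ z

  when-cong : ∀ {w z} c → w ≈ z → (w when c) ≈ (z when c)
  when-cong true  w≈z = w≈z
  when-cong false _   = S.refl

  ∑-filter : ∀ {P : A → Set} (P? : ∀ a → Dec (P a)) as f →
             ∑ (filter P? as) f ≈ ∑ as λ a → f a when does (P? a)
  ∑-filter P? []       f = S.refl
  ∑-filter P? (a ∷ as) f with does (P? a)
  ... | true  = S.+-congˡ (∑-filter P? as f)
  ... | false = S.trans (∑-filter P? as f) (S.sym (S.+-identityˡ _))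

  -- Weighted sums and their expansion over the diamond

  module Weighted (p q : Carrier) where

    W : ∀ {m} → Graph (2 ℕ.+ m) → Carrier
    W H = p ^ corank H * q ^ defect H

    -- At `G n`, with `x - 1` for `p` and `y - 1` for `q`, these become `T₁ n` and `N n`.
    joinedSum separatedSum : ∀ {m} → Graph (2 ℕ.+ m) → Carrier
    joinedSum    Γ = ∑ (spanningSubgraphs Γ) λ H → W H when conn H X Y
    separatedSum Γ = ∑ (spanningSubgraphs Γ) λ H → W H when not (conn H X Y)

    -- A linear form in `t` and `n`; nesting four of them gives a quartic form.
    expand : Carrier → Carrier → (Bool → Carrier) → Carrier
    expand t n φ = φ true * t + φ false * n

    module _ {m} (Γ : Graph (2 ℕ.+ m)) where

      private
        expandΓ : (Bool → Carrier) → Carrier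
        expandΓ = expand (joinedSum Γ) (separatedSum Γ)

      ∑-expand : ∀ φ → ∑ (spanningSubgraphs Γ) (λ H → φ (conn H X Y) * W H) ≈ expandΓ φ
      ∑-expand φ = begin
        ∑ Hs (λ H → φ (conn H X Y) * W H)
          ≈⟨ ∑-cong Hs (λ H → split (W H) (conn H X Y)) ⟩
        ∑ Hs (λ H → φ true * (W H when conn H X Y) + φ false * (W H when not (conn H X Y)))
          ≈⟨ ∑-+ Hs _ _ ⟩
        ∑ Hs (λ H → φ true * (W H when conn H X Y)) + ∑ Hs (λ H → φ false * (W H when not (conn H X Y)))
          ≈⟨ +-cong (∑-*ˡ (φ true) Hs _) (∑-*ˡ (φ false) Hs _) ⟩
        expandΓ φ ∎
        where
        Hs = spanningSubgraphs Γ
        split : ∀ w c → φ c * w ≈ φ true * (w when c) + φ false * (w when not c)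
        split w true  = S.sym (S.trans (S.+-congˡ (S.zeroʳ _)) (S.+-identityʳ _))
        split w false = S.sym (S.trans (S.+-congʳ (S.zeroʳ _)) (S.+-identityˡ _))

      ∑-expand-* : ∀ φ z → ∑ (spanningSubgraphs Γ) (λ H → φ (conn H X Y) * (W H * z)) ≈ expandΓ φ * z
      ∑-expand-* φ z = S.trans
        (∑-cong (spanningSubgraphs Γ) (λ H → S.sym (S.*-assoc _ _ z)))
        (S.trans (∑-*ʳ z (spanningSubgraphs Γ) _) (S.*-congʳ (∑-expand φ)))

      -- The innermost sum is expanded first. Hence `W H₃` leads the product, and what follows it is
      -- constant in `H₃`.
      ∑-expand⁴ : ∀ (φ : Bool → Bool → Bool → Bool → Carrier) →
        (∑ (spanningSubgraphs Γ) λ H₀ → ∑ (spanningSubgraphs Γ) λ H₁ →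
         ∑ (spanningSubgraphs Γ) λ H₂ → ∑ (spanningSubgraphs Γ) λ H₃ →
           φ (conn H₀ X Y) (conn H₁ X Y) (conn H₂ X Y) (conn H₃ X Y) *
             (W H₃ * (W H₂ * (W H₁ * W H₀)))) ≈
        (expandΓ λ c₀ → expandΓ λ c₁ → expandΓ λ c₂ → expandΓ λ c₃ → φ c₀ c₁ c₂ c₃)
      ∑-expand⁴ φ = S.trans
        (∑-cong Hs λ H₀ → S.trans
          (∑-cong Hs λ H₁ → S.trans
            (∑-cong Hs λ H₂ → ∑-expand-* (φ (conn H₀ X Y) (conn H₁ X Y) (conn H₂ X Y)) _)
            (∑-expand-* (λ c₂ → expandΓ (φ (conn H₀ X Y) (conn H₁ X Y) c₂)) _))
          (∑-expand-* (λ c₁ → expandΓ λ c₂ → expandΓ (φ (conn H₀ X Y) c₁ c₂)) _))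
        (∑-expand (λ c₀ → expandΓ λ c₁ → expandΓ λ c₂ → expandΓ (φ c₀ c₁ c₂)))
        where Hs = spanningSubgraphs Γ

    shapeWeight : ℕ → Bool → (Fin 4 → Bool) → Carrier
    shapeWeight m e c = p ^ shape-corank m e c * q ^ defect (shape m e c)

    W-glued : ∀ {m} e (H : Fin 4 → Graph (2 ℕ.+ m)) →
      W (glued e H) ≈ shapeWeight m e (joins H) * (W (H 3F) * (W (H 2F) * (W (H 1F) * W (H 0F))))
    W-glued {m} e H = begin
      p ^ corank (glued e H) * q ^ defect (glued e H)
        ≈⟨ *-cong (^-congʳ p (corank-glued e H)) (^-congʳ q (defect-glued e H)) ⟩
      p ^ (sum (map (corank ∘ H) (allFin 4)) ℕ.+ shape-corank m e (joins H)) *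
      q ^ (sum (map (defect ∘ H) (allFin 4)) ℕ.+ defect (shape m e (joins H)))
        ≈⟨ *-cong (split p (corank ∘ H) _) (split q (defect ∘ H) _) ⟩
      -- Sorts the factors by copy, last copy first, as `∑-expand⁴` expects; each trailing `con 1`
      -- stems from the end of a list sum.
      _ ≈⟨ solve 10 (λ a₀ a₁ a₂ a₃ a b₀ b₁ b₂ b₃ b →
             a₀ :* (a₁ :* (a₂ :* (a₃ :* con 1))) :* a :* (b₀ :* (b₁ :* (b₂ :* (b₃ :* con 1))) :* b) :=
             a :* b :* (a₃ :* b₃ :* (a₂ :* b₂ :* (a₁ :* b₁ :* (a₀ :* b₀)))))
             S.refl (P 0F) (P 1F) (P 2F) (P 3F) (p ^ shape-corank m e (joins H))
                    (Q 0F) (Q 1F) (Q 2F) (Q 3F) (q ^ defect (shape m e (joins H))) ⟩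
      _ ∎
      where
      P Q : Fin 4 → Carrier
      P i = p ^ corank (H i)
      Q i = q ^ defect (H i)
      split : ∀ z (f : Fin 4 → ℕ) k → z ^ (sum (map f (allFin 4)) ℕ.+ k) ≈
        z ^ f 0F * (z ^ f 1F * (z ^ f 2F * (z ^ f 3F * 1#))) * z ^ k
      split z f k = S.trans (^-homo-* z (sum (map f (allFin 4))) k) (S.*-congʳ
        (S.trans (^-homo-* z (f 0F) _) (S.*-congˡ
        (S.trans (^-homo-* z (f 1F) _) (S.*-congˡ
        (S.trans (^-homo-* z (f 2F) _) (S.*-congˡ (^-homo-* z (f 3F) 0))))))))

    selected : ℕ → (Bool → Bool) → Bool → (Fin 4 → Bool) → Carrier
    selected m χ e c = shapeWeight m e c when χ (conn (shape m e c) X Y)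

    part : ℕ → (Bool → Bool) → (t n : Carrier) → Bool → Carrier
    part m χ t n e = expand t n λ c₀ → expand t n λ c₁ → expand t n λ c₂ → expand t n λ c₃ →
      selected m χ e (four c₀ c₁ c₂ c₃)

    parts : ℕ → (Bool → Bool) → (t n : Carrier) → Carrier
    parts m χ t n = part m χ t n false + part m χ t n true

    -- χ = id selects the subgraphs joining X and Y, χ = not those separating them.
    module _ {m} (Γ : Graph (2 ℕ.+ m)) (χ : Bool → Bool) where

      private
        f : Graph (4 ℕ.+ 4 ℕ.* m) → Carrier
        f H = W H when χ (conn H X Y)

        f-glued : ∀ e (H : Fin 4 → Graph (2 ℕ.+ m)) → f (glued e H) ≈
          selected m χ e (joins H) * (W (H 3F) * (W (H 2F) * (W (H 1F) * W (H 0F))))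
        f-glued e H = begin
          W (glued e H) when χ (conn (glued e H) X Y)
            ≡⟨ cong (λ c → W (glued e H) when χ c) (conn-glued e H) ⟩
          W (glued e H) when χ (conn (shape m e (joins H)) X Y)
            ≈⟨ when-cong (χ (conn (shape m e (joins H)) X Y)) (W-glued e H) ⟩
          _ ≈⟨ when-* _ _ (χ (conn (shape m e (joins H)) X Y)) ⟨
          _ ∎

        -- One copy is split off at a time; after the fourth the empty list is left, whose only
        -- sublist gives one summand plus zero.
        ∑-copies : (h : Graph (4 ℕ.+ 4 ℕ.* m) → Carrier) →
          ∑ (spanningSubgraphs (copies (λ _ → Γ) (allFin 4))) h ≈
          ∑ (spanningSubgraphs Γ) λ H₀ → ∑ (spanningSubgraphs Γ) λ H₁ →
          ∑ (spanningSubgraphs Γ) λ H₂ → ∑ (spanningSubgraphs Γ) λ H₃ →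
            h (copies (four H₀ H₁ H₂ H₃) (allFin 4))
        ∑-copies h =
          S.trans (∑-sublists-map-++ _ Γ _ h)                                      (∑-cong Hs λ H₀ →
          S.trans (∑-sublists-map-++ _ Γ _ (h ∘ (image (glue 0F) H₀ ++_)))          (∑-cong Hs λ H₁ →
          S.trans (∑-sublists-map-++ _ Γ _
            (λ L → h (image (glue 0F) H₀ ++ image (glue 1F) H₁ ++ L)))              (∑-cong Hs λ H₂ →
          S.trans (∑-sublists-map-++ _ Γ _
            (λ L → h (image (glue 0F) H₀ ++ image (glue 1F) H₁ ++ image (glue 2F) H₂ ++ L)))
                                                                                    (∑-cong Hs λ H₃ →
          S.+-identityʳ _))))
          where Hs = spanningSubgraphs Γ

        ∑-part : ∀ e →
          ∑ (spanningSubgraphs (copies (λ _ → Γ) (allFin 4))) (λ L → f (edge e a b ++ L)) ≈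
          part m χ (joinedSum Γ) (separatedSum Γ) e
        ∑-part e = S.trans (∑-copies (λ L → f (edge e a b ++ L))) (S.trans
          (∑-cong Hs λ H₀ → ∑-cong Hs λ H₁ → ∑-cong Hs λ H₂ → ∑-cong Hs λ H₃ →
            f-glued e (four H₀ H₁ H₂ H₃))
          (∑-expand⁴ Γ λ c₀ c₁ c₂ c₃ → selected m χ e (four c₀ c₁ c₂ c₃)))
          where Hs = spanningSubgraphs Γ

      ∑-next : ∑ (spanningSubgraphs (next Γ)) (λ H → W H when χ (conn H X Y)) ≈
               parts m χ (joinedSum Γ) (separatedSum Γ)
      ∑-next = S.trans (∑-sublists-∷ (a , b) (copies (λ _ → Γ) (allFin 4)) f)
        (+-cong (∑-part false) (∑-part true))

    module _ (m : ℕ) where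

      private
        _:when_ : Expr 4 → Bool → Expr 4
        w :when c = if c then w else con 0

        :expand : Expr 4 → Expr 4 → (Bool → Expr 4) → Expr 4
        :expand t n φ = φ true :* t :+ φ false :* n

        -- The syntax tree of `parts` for the solver. On concrete Booleans the exponents and
        -- conditions compute, so both unfold to the same expression.
        :parts : (Bool → Bool) → (p q t n : Expr 4) → Expr 4
        :parts χ p q t n = part′ false :+ part′ true
          where
          part′ : Bool → Expr 4
          part′ e = :expand t n λ c₀ → :expand t n λ c₁ → :expand t n λ c₂ → :expand t n λ c₃ →
            let c = four c₀ c₁ c₂ c₃ in
            (p :^ shape-corank m e c :* q :^ defect (shape m e c)) :when χ (conn (shape m e c) X Y)

      -- The 4-cycle without and with its chord gives `q` and `q ^ 2`. Each of the four triples of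
      -- sides gives `1 + q`. Of the pairs, the two paths through `a` or `b` give `p + 1` each, and
      -- the two opposite pairs, joined only by the chord, give 1 each.
      joined-identity : ∀ t n → parts m id t n ≈
        (q + 1#) * q * t ^ 4 + 4 · ((q + 1#) * t ^ 3 * n) +
        (2 · (p + 1#) + 2 · 1#) * t ^ 2 * n ^ 2
      joined-identity t n = solve 4 (λ p q t n → :parts id p q t n :=
        (q :+ con 1) :* q :* t :^ 4 :+ 4 :× ((q :+ con 1) :* t :^ 3 :* n) :+
        (2 :× (p :+ con 1) :+ 2 :× con 1) :* t :^ 2 :* n :^ 2) S.refl p q t n

      -- The two pairs of sides meeting at `X` or at `Y` give `1 + q` each, the two opposite pairs
      -- without the chord 1 each, each single side `p + 1`, and no side at all `p ^ 2 + p`.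
      separated-identity : ∀ t n → parts m not t n ≈
        (2 · (q + 1#) + 2 · 1#) * t ^ 2 * n ^ 2 + 4 · ((p + 1#) * t * n ^ 3) +
        (p + 1#) * p * n ^ 4
      separated-identity t n = solve 4 (λ p q t n → :parts not p q t n :=
        (2 :× (q :+ con 1) :+ 2 :× con 1) :* t :^ 2 :* n :^ 2 :+ 4 :× ((p :+ con 1) :* t :* n :^ 3) :+
        (p :+ con 1) :* p :* n :^ 4) S.refl p q t n

    module _ {x′ y′ t t′ n n′} (x≈ : p + 1# ≈ x′) (y≈ : q + 1# ≈ y′) (t≈ : t ≈ t′) (n≈ : n ≈ n′) where

      private
        2·+2-cong : ∀ {z w} → z ≈ w → 2 · z + 2 · 1# ≈ 2 · w + 2 · 1#
        2·+2-cong z≈w = S.+-congʳ (×-congʳ 2 z≈w)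

      joined-recurrence : ∀ m → parts m id t n ≈
        y′ * q * t′ ^ 4 + 4 · (y′ * t′ ^ 3 * n′) + (2 · x′ + 2 · 1#) * t′ ^ 2 * n′ ^ 2
      joined-recurrence m = S.trans (joined-identity m t n) (+-cong (+-cong
        (*-cong (S.*-congʳ y≈) (^-congˡ 4 t≈))
        (×-congʳ 4 (*-cong (*-cong y≈ (^-congˡ 3 t≈)) n≈)))
        (*-cong (*-cong (2·+2-cong x≈) (^-congˡ 2 t≈)) (^-congˡ 2 n≈)))

      separated-recurrence : ∀ m → parts m not t n ≈
        (2 · y′ + 2 · 1#) * t′ ^ 2 * n′ ^ 2 + 4 · (x′ * t′ * n′ ^ 3) + x′ * p * n′ ^ 4
      separated-recurrence m = S.trans (separated-identity m t n) (+-cong (+-cong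
        (*-cong (*-cong (2·+2-cong y≈) (^-congˡ 2 t≈)) (^-congˡ 2 n≈))
        (×-congʳ 4 (*-cong (*-cong x≈ t≈) (^-congˡ 3 n≈))))
        (*-cong (S.*-congʳ x≈) (^-congˡ 4 n≈)))

    joinedSum-K₂ : joinedSum (G 0) ≈ 1#
    joinedSum-K₂ = solve 0 (con 0 :+ (con 1 :* con 1 :+ con 0) := con 1) S.refl

    separatedSum-K₂ : separatedSum (G 0) ≈ 1#
    separatedSum-K₂ = solve 0 (con 1 :* con 1 :+ (con 0 :+ con 0) := con 1) S.refl

-- Specialisation to ℤ[x,y]

module _ {c ℓ} (R : CommutativeRing c ℓ) where

  private
    module R = CommutativeRing R
    module P = Polynomial R
    module P[t] = CommutativeRing P.commutativeRing
    open SetoidReasoning R.setoid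

    t-1 : P.Poly
    t-1 = P.indeterminate P[t].- P[t].1#

    -- The first factor is what the constant coefficient of `t-1` unfolds to.
    -1*≈ : ∀ u → (R.0# R.+ R.- R.1#) R.* u R.≈ R.- u
    -1*≈ u = R.trans (R.*-congʳ (R.+-identityˡ _)) (RingProperties.-1*x≈-x R.ring u)

    coeff-zero : ∀ p → P.coeff (t-1 P.* p) 0 R.≈ R.- P.coeff p 0
    coeff-zero p = begin
      _ ≈⟨ P.coeff-+ (P.scale _ p) _ 0 ⟩
      _ ≈⟨ R.+-identityʳ _ ⟩
      _ ≈⟨ P.coeff-scale _ p 0 ⟩
      _ ≈⟨ -1*≈ _ ⟩
      _ ∎

    coeff-suc : ∀ p i → P.coeff (t-1 P.* p) (suc i) R.≈ R.- P.coeff p (suc i) R.+ P.coeff p i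
    coeff-suc p i = begin
      _ ≈⟨ P.coeff-+ (P.scale _ p) (R.0# ∷ _) (suc i) ⟩
      _ ≈⟨ R.+-cong (R.trans (P.coeff-scale _ p (suc i)) (-1*≈ _)) (begin
             _ ≈⟨ P.coeff-+ (P.scale R.1# p) (R.0# ∷ []) i ⟩
             _ ≈⟨ R.+-cong (R.trans (P.coeff-scale R.1# p i) (R.*-identityˡ _)) (coeff-0∷[] i) ⟩
             _ ≈⟨ R.+-identityʳ _ ⟩
             _ ∎) ⟩
      _ ∎
      where
      coeff-0∷[] : ∀ i → P.coeff (R.0# ∷ []) i R.≈ R.0#
      coeff-0∷[] zero    = R.refl
      coeff-0∷[] (suc i) = R.refl

  -- The constant coefficient of `t-1` is minus one, so the coefficients of `p` are recovered from
  -- those of the product one by one, from the lowest upwards.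
  t-1-cancel : ∀ p q → t-1 P.* p P.≈ t-1 P.* q → p P.≈ q
  t-1-cancel p q e .P.coeff-≈ = go
    where
    go : ∀ i → P.coeff p i R.≈ P.coeff q i
    go zero    = -‿injective (begin
      R.- P.coeff p 0 ≈⟨ coeff-zero p ⟨
      _               ≈⟨ P.coeff-≈ e 0 ⟩
      _               ≈⟨ coeff-zero q ⟩
      R.- P.coeff q 0 ∎)
      where open RingProperties R.ring using (-‿injective)
    go (suc i) = -‿injective (+-cancelʳ (P.coeff p i) _ _ (begin
      R.- P.coeff p (suc i) R.+ P.coeff p i ≈⟨ coeff-suc p i ⟨
      _                                     ≈⟨ P.coeff-≈ e (suc i) ⟩
      _                                     ≈⟨ coeff-suc q i ⟩
      R.- P.coeff q (suc i) R.+ P.coeff q i ≈⟨ R.+-congˡ (go i) ⟨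
      R.- P.coeff q (suc i) R.+ P.coeff p i ∎))
      where open RingProperties R.ring using (-‿injective; +-cancelʳ)

-- Tutte polynomials of the graphs `G n`

open Defs using (_+_; _*_; _≈_; 0#; 1#; _^_; _·_; ∑)

module ℤ[x,y] = CommutativeRing ℤ[x,y]
open Sums ℤ[x,y].commutativeSemiring hiding (∑)
open Weighted (x - 1#) (y - 1#)
open SetoidReasoning ℤ[x,y].setoid

x-1-cancel : ∀ p q → (x - 1#) * p ≈ (x - 1#) * q → p ≈ q
x-1-cancel = t-1-cancel (Polynomial.commutativeRing ℤ.+-*-commutativeRing)

z-1+1≈z : ∀ z → (z - 1#) + 1# ≈ z
z-1+1≈z z = ℤ[x,y].trans (ℤ[x,y].+-assoc z _ 1#)
  (ℤ[x,y].trans (ℤ[x,y].+-congˡ (ℤ[x,y].-‿inverseˡ 1#)) (ℤ[x,y].+-identityʳ z))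

r≡rank : ∀ {v} (H : Graph v) → r H ≡ rank H
r≡rank H = trans (cong (ℕ._∸ k H) (sym (rank+k H))) (ℕ.m+n∸n≡m (rank H) (k H))

nullity≡defect : ∀ {v} (H : Graph v) → nullity H ≡ defect H
nullity≡defect H = trans
  (cong₂ ℕ._∸_ (ℕ.+-comm (length H) (k H)) (trans (sym (rank+k H)) (ℕ.+-comm (rank H) (k H))))
  (ℕ.[m+n]∸[m+o]≡n∸o (k H) (length H) (rank H))

module _ (n : ℕ) (H : Graph (2 ℕ.+ others n)) where

  weight-rank : weight (G n) H ≡
    (x - 1#) ^ (suc (others n) ℕ.∸ rank H) * (y - 1#) ^ defect H
  weight-rank = cong₂ (λ i j → (x - 1#) ^ i * (y - 1#) ^ j)
    (cong₂ ℕ._∸_ (trans (r≡rank (G n)) (rank-G n)) (r≡rank H)) (nullity≡defect H)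

  weight-joined : weight (G n) H when conn H X Y ≈ W H when conn H X Y
  weight-joined = ℤ[x,y].trans
    (ℤ[x,y].reflexive (cong (_when conn H X Y) weight-rank)) (go (conn H X Y))
    where
    go : ∀ c → ((x - 1#) ^ (suc (others n) ℕ.∸ rank H) * (y - 1#) ^ defect H) when c ≈
               ((x - 1#) ^ (suc (others n) ℕ.∸ (𝟙 (not c) ℕ.+ rank H)) * (y - 1#) ^ defect H) when c
    go true  = ℤ[x,y].refl
    go false = ℤ[x,y].refl

  weight-separated : weight (G n) H when not (conn H X Y) ≈
                     (x - 1#) * (W H when not (conn H X Y))
  weight-separated = ℤ[x,y].trans
    (ℤ[x,y].reflexive (cong (_when not (conn H X Y)) weight-rank))
    (go (conn H X Y) (rank≤ ((X , Y) ∷ H)))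
    where
    go : ∀ c → 𝟙 (not c) ℕ.+ rank H ≤ suc (others n) →
      ((x - 1#) ^ (suc (others n) ℕ.∸ rank H) * (y - 1#) ^ defect H) when not c ≈ (x - 1#) *
      (((x - 1#) ^ (suc (others n) ℕ.∸ (𝟙 (not c) ℕ.+ rank H)) * (y - 1#) ^ defect H) when not c)
    go true  _        = ℤ[x,y].sym (ℤ[x,y].zeroʳ (x - 1#))
    -- By `le` no truncation occurs: the exponent is a successor, and one factor `x - 1` splits off.
    go false (s≤s le) = ℤ[x,y].trans
      (ℤ[x,y].reflexive (cong (λ i → (x - 1#) ^ i * (y - 1#) ^ defect H) (ℕ.+-∸-assoc 1 le)))
      (ℤ[x,y].*-assoc (x - 1#) ((x - 1#) ^ (others n ℕ.∸ rank H)) ((y - 1#) ^ defect H))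

T₁≈joinedSum : ∀ n → T₁ n ≈ joinedSum (G n)
T₁≈joinedSum n = ℤ[x,y].trans (∑-filter (λ H → connected? H X Y) (spanningSubgraphs (G n)) (weight (G n)))
  (∑-cong (spanningSubgraphs (G n)) (weight-joined n))

-- This exhibits the quotient of `T₂ n` by `x - 1`, and so proves the divisibility.
T₂≈separatedSum : ∀ n → T₂ n ≈ (x - 1#) * separatedSum (G n)
T₂≈separatedSum n = begin
  T₂ n ≈⟨ ∑-filter (λ H → ¬? (connected? H X Y)) Hs (weight (G n)) ⟩
  _    ≈⟨ ∑-cong Hs (weight-separated n) ⟩
  _    ≈⟨ ∑-*ˡ (x - 1#) Hs _ ⟩
  (x - 1#) * separatedSum (G n) ∎
  where Hs = spanningSubgraphs (G n)

T≈T₁+T₂ : ∀ n → T n ≈ T₁ n + T₂ n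
T≈T₁+T₂ n = begin
  T n ≈⟨ ∑-cong Hs (λ H → split (weight (G n) H) (conn H X Y)) ⟩
  ∑ Hs (λ H → (weight (G n) H when conn H X Y) + (weight (G n) H when not (conn H X Y)))
      ≈⟨ ∑-+ Hs _ _ ⟩
  _   ≈⟨ ℤ[x,y].+-cong (∑-filter (λ H → connected? H X Y) Hs (weight (G n)))
                       (∑-filter (λ H → ¬? (connected? H X Y)) Hs (weight (G n))) ⟨
  T₁ n + T₂ n ∎
  where
  Hs = spanningSubgraphs (G n)
  split : ∀ w c → w ≈ (w when c) + (w when not c)
  split w true  = ℤ[x,y].sym (ℤ[x,y].+-identityʳ w)
  split w false = ℤ[x,y].sym (ℤ[x,y].+-identityˡ w)

module _ (N : ℕ → ℤ[x,y]ᶜ) (quotient : IsQuotient N) where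

  N≈separatedSum : ∀ n → N n ≈ separatedSum (G n)
  N≈separatedSum n = x-1-cancel (N n) (separatedSum (G n)) (begin
    (x - 1#) * N n                ≈⟨ quotient n ⟨
    T₂ n                          ≈⟨ T₂≈separatedSum n ⟩
    (x - 1#) * separatedSum (G n) ∎)

  T-split : ∀ n → T n ≈ T₁ n + (x - 1#) * N n
  T-split n = ℤ[x,y].trans (T≈T₁+T₂ n) (ℤ[x,y].+-congˡ (quotient n))

  private
    module _ (n : ℕ) where
      t≈ : joinedSum (G n) ≈ T₁ n
      t≈ = ℤ[x,y].sym (T₁≈joinedSum n)
      n≈ : separatedSum (G n) ≈ N n
      n≈ = ℤ[x,y].sym (N≈separatedSum n)

  T₁-recurrence : ∀ n → T₁ (suc n) ≈ y * (y - 1#) * T₁ n ^ 4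
                                    + 4 · (y * T₁ n ^ 3 * N n)
                                    + (2 · x + 2 · 1#) * T₁ n ^ 2 * N n ^ 2
  T₁-recurrence n = begin
    T₁ (suc n)              ≈⟨ T₁≈joinedSum (suc n) ⟩
    joinedSum (G (suc n))   ≈⟨ ∑-next (G n) id ⟩
    _                       ≈⟨ joined-recurrence (z-1+1≈z x) (z-1+1≈z y) (t≈ n) (n≈ n) (others n) ⟩
    _ ∎

  N-recurrence : ∀ n → N (suc n) ≈ (2 · y + 2 · 1#) * T₁ n ^ 2 * N n ^ 2
                                  + 4 · (x * T₁ n * N n ^ 3)
                                  + x * (x - 1#) * N n ^ 4
  N-recurrence n = begin
    N (suc n)                ≈⟨ N≈separatedSum (suc n) ⟩
    separatedSum (G (suc n)) ≈⟨ ∑-next (G n) not ⟩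
    _                        ≈⟨ separated-recurrence (z-1+1≈z x) (z-1+1≈z y) (t≈ n) (n≈ n) (others n) ⟩
    _ ∎

theorem2 : ∃ IsQuotient ×
    (∀ N → IsQuotient N →
    (∀ n →
    (T (suc n) ≈ T₁ (suc n) + (x - 1#) * N (suc n)) ×
    (T₁ (suc n) ≈ y * (y - 1#) * T₁ n ^ 4
    + 4 · (y * T₁ n ^ 3 * N n)
    + (2 · x + 2 · 1#) * T₁ n ^ 2 * N n ^ 2) ×
    (N (suc n) ≈ (2 · y + 2 · 1#) * T₁ n ^ 2 * N n ^ 2
    + 4 · (x * T₁ n * N n ^ 3)
    + x * (x - 1#) * N n ^ 4)) ×
    (T₁ 0 ≈ 1#) × (N 0 ≈ 1#))
theorem2 =
  ((λ n → separatedSum (G n)) , T₂≈separatedSum) ,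
  λ N quotient →
    (λ n → T-split N quotient (suc n) , T₁-recurrence N quotient n , N-recurrence N quotient n) ,
    ℤ[x,y].trans (T₁≈joinedSum 0) joinedSum-K₂ ,
    ℤ[x,y].trans (N≈separatedSum N quotient 0) separatedSum-K₂
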